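{- If $\alpha$ is a monotone unbalanced connective and the support of $\mu$ does not contain the negations of projections, then the limiting distribution of the growth process $(\mu,\alpha)$ on $n$ variables is concentrated on a threshold function, i.e. on $T_m(x_1,\dots,x_n)$ for some $m\in\{0,1,\dots,n+1\}$.
   Context: A connective is a $k$-adic Boolean function $\alpha:\{0,1\}^k\to\{0,1\}$; it is balanced if it takes the value 1 on exactly half of its inputs, and unbalanced otherwise. The initial distribution $\mu$ is uniform on its support, which contains the $n$ projections $x_1,\dots,x_n$ and, here, no negations, and contains neither, one, or both of the constant functions $0,1$. The growth process $(\mu,\alpha)$ gives distributions $\pi_i$ on $n$-adic Boolean functions: $\pi_0=\mu$, and for $i\ge1$, $\pi_i(f)$ is the probability that $\alpha(g_1,\dots,g_k)=f$ where $g_1,\dots,g_k$ are independent random functions distributed according to $\pi_{i-1}$. The limiting distribution is $\pi=\lim_{i\to\infty}\pi_i$ (pointwise); it is concentrated on $f$ if $\pi(f)=1$. The threshold function $T_m(x_1,\dots,x_n)$ is 1 if and only if at least $m$ of its $n$ arguments are 1; the constants $T_{n+1}=0$ and $T_0=1$ are included as special cases. -}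

module Defs where

open import Data.Bool using (Bool; true; false; not; if_then_else_)
import Data.Bool as Bool
import Data.Bool.Properties as Bool
open import Data.Fin using (Fin)
open import Data.Integer using (+_)
open import Data.List as List using (List; []; _∷_; length; cartesianProductWith)
open import Data.List.Relation.Unary.All using (All)
open import Data.List.Relation.Unary.AllPairs using (AllPairs)
open import Data.List.Relation.Unary.Any using (Any; any?)
open import Data.Nat as ℕ using (ℕ; zero; suc; NonZero)
open import Data.Product using (∃-syntax; _×_; _,_)
open import Data.Rational using (ℚ; 0ℚ; 1ℚ; _+_; _*_; _-_; _/_; ∣_∣; _<_)
open import Data.Sum using (_⊎_)
open import Data.Vec as Vec using (Vec; []; _∷_; lookup)
open import Data.Vec.Relation.Binary.Pointwise.Inductive using (Pointwise)
open import Function using (const; _∘_)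
open import Relation.Binary.PropositionalEquality using (_≡_; _≗_)
open import Relation.Nullary using (¬_; Dec; does)
open import Relation.Nullary.Decidable using (map′; _×-dec_)

------------------------------------------------------------------------
-- Boolean functions

-- Functions are always compared pointwise, by _≗_.
BoolFun : ℕ → Set
BoolFun n = Vec Bool n → Bool

_≗?_ : ∀ {n} (f g : BoolFun n) → Dec (f ≗ g)
_≗?_ {zero}  f g = map′ (λ { e [] → e }) (λ e → e []) (f [] Bool.≟ g [])
_≗?_ {suc n} f g =
  map′ (λ { (e₀ , e₁) (false ∷ x) → e₀ x ; (e₀ , e₁) (true ∷ x) → e₁ x })
       (λ e → (λ x → e (false ∷ x)) , (λ x → e (true ∷ x)))
       (((f ∘ (false ∷_)) ≗? (g ∘ (false ∷_)))
         ×-dec ((f ∘ (true ∷_)) ≗? (g ∘ (true ∷_))))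

infix 4 _≗?_ _∈_ _∉_ _∈?_

_∈_ _∉_ : ∀ {n} → BoolFun n → List (BoolFun n) → Set
f ∈ S = Any (f ≗_) S
f ∉ S = ¬ (f ∈ S)

_∈?_ : ∀ {n} (f : BoolFun n) (S : List (BoolFun n)) → Dec (f ∈ S)
f ∈? S = any? (f ≗?_) S

-- All k-tuples of entries of a list; each occurs once if the list has
-- no repetitions.
tuples : ∀ {A : Set} (k : ℕ) → List A → List (Vec A k)
tuples zero    xs = [] ∷ []
tuples (suc k) xs = cartesianProductWith _∷_ xs (tuples k xs)

inputs : ∀ k → List (Vec Bool k)
inputs k = tuples k (false ∷ true ∷ [])

-- The function whose restrictions to first argument 0 and 1 are f₀ and f₁.
branch : ∀ {n} → BoolFun n → BoolFun n → BoolFun (suc n)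
branch f₀ f₁ (b ∷ x) = if b then f₁ x else f₀ x

-- Every n-adic Boolean function is pointwise equal to exactly one entry.
allFuns : ∀ n → List (BoolFun n)
allFuns zero    = const false ∷ const true ∷ []
allFuns (suc n) = cartesianProductWith branch (allFuns n) (allFuns n)

compose : ∀ {k n} → BoolFun k → Vec (BoolFun n) k → BoolFun n
compose α gs x = α (Vec.map (λ g → g x) gs)

projection negation : ∀ {n} → Fin n → BoolFun n
projection i x = lookup x i
negation   i x = not (lookup x i)

weight : ∀ {n} → Vec Bool n → ℕ
weight = Vec.count (Bool._≟ true)

threshold : ∀ {n} → ℕ → BoolFun n
threshold m x = does (m ℕ.≤? weight x)

Monotone : ∀ {k} → BoolFun k → Set
Monotone α = ∀ {x y} → Pointwise Bool._≤_ x y → α x Bool.≤ α y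

Balanced : ∀ {k} → BoolFun k → Set
Balanced {k} α =
  2 ℕ.* length (List.filter (λ x → α x Bool.≟ true) (inputs k)) ≡ 2 ℕ.^ k

Unbalanced : ∀ {k} → BoolFun k → Set
Unbalanced α = ¬ Balanced α

------------------------------------------------------------------------
-- Initial distributions

record IsInitialSupport {n} (S : List (BoolFun n)) : Set where
  field
    distinct            : AllPairs (λ f g → ¬ (f ≗ g)) S
    containsProjections : ∀ i → projection i ∈ S
    onlyLiteralsOrConstants :
      All (λ f → (∃[ i ] f ≗ projection i) ⊎ (∃[ i ] f ≗ negation i)
               ⊎ (∃[ b ] f ≗ const b)) S

NoNegations : ∀ {n} → List (BoolFun n) → Set
NoNegations S = ∀ i → negation i ∉ S

-- Distributions are given by their probability mass functions.
Mass : ℕ → Set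
Mass n = BoolFun n → ℚ

-- This is a probability distribution when S has no repetitions.
uniform : ∀ {n} (S : List (BoolFun n)) .{{_ : NonZero (length S)}} → Mass n
uniform S f = if does (f ∈? S) then + 1 / length S else 0ℚ

------------------------------------------------------------------------
-- The growth process

sum : List ℚ → ℚ
sum = List.foldr _+_ 0ℚ

-- The probability of drawing the tuple gs in independent draws from π.
productMass : ∀ {k n} → Mass n → Vec (BoolFun n) k → ℚ
productMass π gs = Vec.foldr′ _*_ 1ℚ (Vec.map π gs)

-- The probability of the event α(g₁, …, gₖ) = f, as a sum over all
-- tuples (g₁, …, gₖ).
grow : ∀ {k n} → BoolFun k → Mass n → Mass n
grow {k} {n} α π f =
  sum (List.map (λ gs → if does (compose α gs ≗? f) then productMass π gs else 0ℚ)
                (tuples k (allFuns n)))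

growth : ∀ {k n} → Mass n → BoolFun k → ℕ → Mass n
growth μ α zero    = μ
growth μ α (suc i) = grow α (growth μ α i)

infix 4 _⟶_

_⟶_ : (ℕ → ℚ) → ℚ → Set
s ⟶ l = ∀ ε → 0ℚ < ε → ∃[ N ] (∀ i → N ℕ.≤ i → ∣ s i - l ∣ < ε)

-- Limits are taken in ℚ. A real limit of masses need not be rational in
-- general, but the limit of a process concentrated on a single function
-- takes only the values 0 and 1.
IsLimitingDistribution : ∀ {k n} → Mass n → BoolFun k → Mass n → Set
IsLimitingDistribution μ α π = ∀ f → (λ i → growth μ α i f) ⟶ π f

ConcentratedOn : ∀ {n} → Mass n → BoolFun n → Set
ConcentratedOn π f = π f ≡ 1ℚ

{-# OPTIONS --safe #-}
module Submission where

-- Fix an input x and let p be the probability that a random function drawn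
-- from the current distribution takes the value 1 at x. One growth step
-- replaces p by A(p), where A(p) is the probability that the connective takes
-- the value 1 on independent bits that are 1 with probability p. Initially p
-- is an increasing function of the number of ones in x: the projections
-- contribute that number, and the constant 1 contributes the same to every x.
-- So it is enough to show that the iterates of A starting from a rational p
-- tend to 0 or 1, and to 1 whenever they do so from a smaller p. The limit is
-- then a Boolean function of the weight of x that increases with the weight,
-- which is a threshold function.
--
-- Convergence rests on the following sharpening of monotonicity, an integrated
-- form of the Moore-Shannon inequality: the odds of A(p) divided by the odds
-- of p do not decrease as p grows (odds-ratio). If A(p) < p, the odds are
-- therefore multiplied by at most a fixed ratio below 1 at p and at every
-- smaller point, and the iterates tend to 0 (Orbit.Interior.falling). If
-- p < A(p), they tend to 1 in the same way (Orbit.Interior.rising). For the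
-- same reason, p < A(p) is inherited by larger p (Rises-monotone).
--
-- What remains is A(p) = p with 0 < p < 1, where nothing moves. For rational p
-- it forces the connective to be balanced (fixed⇒balanced). Write the odds of
-- p as s to r in lowest terms. If the connective takes the value 1 on some
-- input with a single one, then it is at least a projection, and A(p) = p
-- only if it is that projection, which is balanced. Otherwise s² divides
-- the numerator of A(p), with denominator (s + r) ^ k, and A(p) = p gives
-- that s divides a power of s + r, so that s = 1. By duality r = 1, and
-- A(1/2) = 1/2 says that the connective is balanced.
--
-- All of this takes place in the natural numbers. A probability is kept as a
-- pair of counts, of hits and of misses, on which A acts through the
-- homogeneous polynomials amp α and amp (∁ α), and the masses of the growth
-- process are written as natural numbers over a common denominator
-- (growth-scaled). The total mass of the functions other than the limit is
-- bounded by the sum over the inputs x of the probabilities of a wrong value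
-- at x (⟦not-≗?⟧≤), each of which is at most C/i after i steps.

open import Defs
open import Data.Bool using (Bool)
open import Data.List using (List; length)
open import Data.Nat using (ℕ; suc; NonZero; _≤_)
open import Data.Product using (∃-syntax; _×_)

open import Data.Bool using (true; false; not; if_then_else_; _∧_; _xor_)
import Data.Bool as Bool
import Data.Bool.Properties as Bool
open import Data.Fin using (Fin; zero; suc)
import Data.Fin.Properties as Fin
open import Data.Integer as ℤ using (+≤+; +<+)
import Data.Integer.Properties as ℤ
open import Data.List as List using ([]; _∷_; _++_; cartesianProductWith; allFin)
import Data.List.Membership.Propositional as Membership
import Data.List.Properties as List
open import Data.List.Relation.Unary.All as All using (All; []; _∷_)
open import Data.List.Relation.Unary.AllPairs using (AllPairs; []; _∷_)
open import Data.List.Relation.Unary.Any as Any using (here; there)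
open import Data.Nat
  using (zero; _<_; _+_; _*_; _^_; _∸_; z≤n; s≤s; _≟_; _<?_; _≤?_;
         ≢-nonZero; >-nonZero; >-nonZero⁻¹)
open import Data.Nat.Coprimality as Coprimality using (Coprime)
open import Data.Nat.Divisibility using (_∣_; divides; ∣1⇒≡1)
open import Data.Nat.DivMod using (_/_; m*[n/m]≡n)
open import Data.Nat.GCD using (gcd; gcd[m,n]∣m; gcd[m,n]∣n; gcd[m,n]≢0)
import Data.Nat.ListAction as ListAction
import Data.Nat.ListAction.Properties as ListAction
open import Data.Nat.Properties hiding (_≟_; _<?_; _≤?_)
open import Data.Nat.Tactic.RingSolver using (solve-∀)
open import Data.Product using (_,_; proj₁; proj₂)
open import Data.Rational as ℚ using (ℚ; 0ℚ; 1ℚ; ∣_∣; mkℚ)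
open import Data.Rational.Literals using (fromℤ)
import Data.Rational.Properties as ℚ
open import Data.Rational.Solver using (module +-*-Solver)
open import Data.Rational.Unnormalised as ℚᵘ using (mkℚᵘ)
import Data.Rational.Unnormalised.Properties as ℚᵘ
open import Data.Sum using (_⊎_; inj₁; inj₂)
open import Data.Vec as Vec using (Vec; []; _∷_; lookup)
import Data.Vec.Properties as Vec
open import Data.Vec.Relation.Binary.Pointwise.Inductive as Pointwise
  using (Pointwise; []; _∷_)
open import Function using (_∘_; const; id)
open import Relation.Binary using (tri<; tri≈; tri>)
open import Relation.Binary.PropositionalEquality
open import Relation.Nullary using (¬_; Dec; yes; no; does; contradiction)
open import Relation.Nullary.Decidable using (_×-dec_; _⊎-dec_; dec-true; dec-false)

open +-*-Solver using (solve; _:*_; _:+_; _:-_; :-_; _:=_; con)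

private variable
  A B C : Set
  k n : ℕ

------------------------------------------------------------------------
-- The amplification polynomial

-- Indicator of a Boolean, as a number.
⟦_⟧ : Bool → ℕ
⟦ b ⟧ = if b then 1 else 0

-- The pointwise negation of α.
∁ : ∀ {k} → BoolFun k → BoolFun k
∁ α x = not (α x)

-- The sum, over the inputs x with α x = 1, of s to the number of ones in x
-- times r to the number of zeros. Divided by (s + r) ^ k, this is the
-- probability that α takes the value 1 when each argument is independently 1
-- with odds s to r.
amp : ∀ {k} → BoolFun k → ℕ → ℕ → ℕ
amp {zero}  α s r = ⟦ α [] ⟧
amp {suc k} α s r = s * amp (α ∘ (true ∷_)) s r + r * amp (α ∘ (false ∷_)) s r

amp-cong : ∀ {k} {α β : BoolFun k} → α ≗ β → ∀ s r → amp α s r ≡ amp β s r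
amp-cong {zero}  e s r = cong ⟦_⟧ (e [])
amp-cong {suc k} e s r =
  cong₂ (λ a b → s * a + r * b) (amp-cong (e ∘ (true ∷_)) s r)
                                (amp-cong (e ∘ (false ∷_)) s r)

⟦⟧-mono : ∀ {b c} → b Bool.≤ c → ⟦ b ⟧ ≤ ⟦ c ⟧
⟦⟧-mono Bool.f≤t = z≤n
⟦⟧-mono Bool.b≤b = ≤-refl

amp-mono : ∀ {k} {α β : BoolFun k} → (∀ x → α x Bool.≤ β x) →
           ∀ s r → amp α s r ≤ amp β s r
amp-mono {zero}  h s r = ⟦⟧-mono (h [])
amp-mono {suc k} h s r = +-mono-≤ (*-monoʳ-≤ s (amp-mono (h ∘ (true ∷_)) s r))
                                  (*-monoʳ-≤ r (amp-mono (h ∘ (false ∷_)) s r))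

amp-mono-args : ∀ {k} (α : BoolFun k) {s s′ r r′} → s ≤ s′ → r ≤ r′ →
                amp α s r ≤ amp α s′ r′
amp-mono-args {zero}  α p q = ≤-refl
amp-mono-args {suc k} α p q = +-mono-≤ (*-mono-≤ p (amp-mono-args (α ∘ (true ∷_)) p q))
                                       (*-mono-≤ q (amp-mono-args (α ∘ (false ∷_)) p q))

amp-pos : ∀ {k} (α : BoolFun k) x {s r} → α x ≡ true → 0 < s → 0 < r → 0 < amp α s r
amp-pos α [] e s>0 r>0 rewrite e = s≤s z≤n
amp-pos α (true ∷ x) e s>0 r>0 =
  ≤-trans (*-mono-≤ s>0 (amp-pos (α ∘ (true ∷_)) x e s>0 r>0)) (m≤m+n _ _)
amp-pos α (false ∷ x) e s>0 r>0 =
  ≤-trans (*-mono-≤ r>0 (amp-pos (α ∘ (false ∷_)) x e s>0 r>0)) (m≤n+m _ _)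

amp-const-false : ∀ {k} {α : BoolFun k} → (∀ x → α x ≡ false) → ∀ s r → amp α s r ≡ 0
amp-const-false {zero}  h s r rewrite h [] = refl
amp-const-false {suc k} h s r
  rewrite amp-const-false (h ∘ (true ∷_)) s r
        | amp-const-false (h ∘ (false ∷_)) s r
        | *-zeroʳ s | *-zeroʳ r = refl

amp-total : ∀ {k} (α : BoolFun k) s r → amp α s r + amp (∁ α) s r ≡ (s + r) ^ k
amp-total {zero} α s r with α []
... | true  = refl
... | false = refl
amp-total {suc k} α s r =
  trans (regroup s r (amp α₁ s r) (amp α₀ s r) (amp (∁ α₁) s r) (amp (∁ α₀) s r))
        (trans (cong₂ (λ a b → s * a + r * b) (amp-total α₁ s r) (amp-total α₀ s r))
               (sym (*-distribʳ-+ ((s + r) ^ k) s r)))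
  where
  α₁ = α ∘ (true ∷_)
  α₀ = α ∘ (false ∷_)
  regroup : ∀ s r a b c d → (s * a + r * b) + (s * c + r * d) ≡ s * (a + c) + r * (b + d)
  regroup = solve-∀

amp-homogeneous : ∀ {k} (α : BoolFun k) g s r → amp α (g * s) (g * r) ≡ g ^ k * amp α s r
amp-homogeneous {zero} α g s r = sym (+-identityʳ _)
amp-homogeneous {suc k} α g s r
  rewrite amp-homogeneous (α ∘ (true ∷_)) g s r
        | amp-homogeneous (α ∘ (false ∷_)) g s r
  = regroup g s r (g ^ k) (amp (α ∘ (true ∷_)) s r) (amp (α ∘ (false ∷_)) s r)
  where
  regroup : ∀ g s r t a b → g * s * (t * a) + g * r * (t * b) ≡ g * t * (s * a + r * b)
  regroup = solve-∀

-- Negating the arguments exchanges the two counts.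
amp-flip : ∀ {k} (α : BoolFun k) s r → amp (α ∘ Vec.map not) s r ≡ amp α r s
amp-flip {zero}  α s r = refl
amp-flip {suc k} α s r =
  trans (cong₂ (λ a b → s * a + r * b) (amp-flip (α ∘ (false ∷_)) s r)
                                       (amp-flip (α ∘ (true ∷_)) s r))
        (+-comm (s * _) _)

∷-monotone : ∀ {k} {α : BoolFun (suc k)} → Monotone α → ∀ b → Monotone (α ∘ (b ∷_))
∷-monotone mon b p = mon (Bool.≤-refl ∷ p)

restriction-mono : ∀ {k} {α : BoolFun (suc k)} → Monotone α →
                   ∀ x → α (false ∷ x) Bool.≤ α (true ∷ x)
restriction-mono mon x = mon (Bool.f≤t ∷ Pointwise.refl Bool.≤-refl)

------------------------------------------------------------------------
-- Monotone functions and odds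

rearrangement : ∀ {p q u v} → p ≤ q → u ≤ v → v * p + u * q ≤ u * p + v * q
rearrangement {p} {u = u} p≤q u≤v
  with e , refl ← m≤n⇒∃[o]m+o≡n p≤q | f , refl ← m≤n⇒∃[o]m+o≡n u≤v
  = subst ((u + f) * p + u * (p + e) ≤_) (expand p e u f) (m≤m+n _ (f * e))
  where
  expand : ∀ p e u f → (u + f) * p + u * (p + e) + f * e ≡ u * p + (u + f) * (p + e)
  expand = solve-∀

-- Two points are compared; the odds at the lower one are X/Y times those at the
-- upper one. For a function of the inputs, a and d stand for its weights of
-- ones and of zeros at the upper point, with total T′, and b and c for those at
-- the lower point, with total T.
module _ {X Y T T′ : ℕ} (X≤Y : X ≤ Y) where
  open ≤-Reasoning

  private
    -- Scaling the odds a to d by X/Y gives the odds X * a to Y * d. This is their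
    -- total.
    D : ℕ → ℕ → ℕ
    D a d = Y * d + X * a

  -- The hypothesis b * d * Y ≤ a * c * X says that the odds b to c are at most
  -- a to d scaled by X/Y. As b + c is fixed, this amounts to an upper bound on b
  -- and a lower bound on c, both with denominator D a d.
  cross-upper : ∀ a b c d → b + c ≡ T → b * d * Y ≤ a * c * X → b * D a d ≤ X * a * T
  cross-upper a b c d refl ih = begin
    b * D a d                 ≡⟨ e₁ a b d X Y ⟩
    b * d * Y + a * b * X     ≤⟨ +-monoˡ-≤ (a * b * X) ih ⟩
    a * c * X + a * b * X     ≡⟨ e₂ a b c X ⟩
    X * a * (b + c)           ∎
    where
    e₁ : ∀ a b d X Y → b * (Y * d + X * a) ≡ b * d * Y + a * b * X
    e₁ = solve-∀
    e₂ : ∀ a b c X → a * c * X + a * b * X ≡ X * a * (b + c)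
    e₂ = solve-∀

  cross-lower : ∀ a b c d → b + c ≡ T → b * d * Y ≤ a * c * X → Y * d * T ≤ c * D a d
  cross-lower a b c d refl ih = begin
    Y * d * (b + c)           ≡⟨ e₁ b c d Y ⟩
    Y * d * c + b * d * Y     ≤⟨ +-monoʳ-≤ (Y * d * c) ih ⟩
    Y * d * c + a * c * X     ≡⟨ e₂ a c d X Y ⟩
    c * D a d                 ∎
    where
    e₁ : ∀ b c d Y → Y * d * (b + c) ≡ Y * d * c + b * d * Y
    e₁ = solve-∀
    e₂ : ∀ a c d X Y → Y * d * c + a * c * X ≡ c * (Y * d + X * a)
    e₂ = solve-∀

  D-upper : ∀ {a d} → a + d ≡ T′ → D a d ≤ Y * T′
  D-upper {a} {d} refl = begin
    Y * d + X * a    ≤⟨ +-monoʳ-≤ (Y * d) (*-monoˡ-≤ a X≤Y) ⟩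
    Y * d + Y * a    ≡⟨ *-distribˡ-+ Y d a ⟨
    Y * (d + a)      ≡⟨ cong (Y *_) (+-comm d a) ⟩
    Y * (a + d)      ∎

  D-lower : ∀ {a d} → a + d ≡ T′ → X * T′ ≤ D a d
  D-lower {a} {d} refl = begin
    X * (a + d)      ≡⟨ cong (X *_) (+-comm a d) ⟩
    X * (d + a)      ≡⟨ *-distribˡ-+ X d a ⟩
    X * d + X * a    ≤⟨ +-monoˡ-≤ (X * a) (*-monoˡ-≤ d X≤Y) ⟩
    Y * d + X * a    ∎

  -- The cross terms in the induction step of odds-ratio. Inserting the bounds on
  -- b₀, b₁, c₀ and c₁ makes both sides combinations of a₀ * d₁ and a₁ * d₀, to
  -- which the rearrangement inequality applies.
  cross : ∀ {a₀ a₁ b₀ b₁ c₀ c₁ d₀ d₁} → 0 < X → 0 < T′ →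
          a₀ + d₀ ≡ T′ → a₁ + d₁ ≡ T′ → b₀ + c₀ ≡ T → b₁ + c₁ ≡ T →
          a₀ ≤ a₁ →
          b₀ * d₀ * Y ≤ a₀ * c₀ * X → b₁ * d₁ * Y ≤ a₁ * c₁ * X →
          Y * Y * (b₀ * d₁) + X * Y * (b₁ * d₀) ≤ X * X * (a₀ * c₁) + X * Y * (a₁ * c₀)
  cross {a₀} {a₁} {b₀} {b₁} {c₀} {c₁} {d₀} {d₁} X>0 T′>0 ad₀ ad₁ bc₀ bc₁ a₀≤a₁ ih₀ ih₁ =
    *-cancelʳ-≤ _ _ (D₀ * D₁) {{>-nonZero DD>0}} (begin
      (Y * Y * (b₀ * d₁) + X * Y * (b₁ * d₀)) * (D₀ * D₁)
        ≡⟨ e₁ X Y b₀ b₁ d₀ d₁ D₀ D₁ ⟩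
      Y * Y * d₁ * D₁ * (b₀ * D₀) + X * Y * d₀ * D₀ * (b₁ * D₁)
        ≤⟨ +-mono-≤ (*-monoʳ-≤ (Y * Y * d₁ * D₁) (cross-upper a₀ b₀ c₀ d₀ bc₀ ih₀))
                    (*-monoʳ-≤ (X * Y * d₀ * D₀) (cross-upper a₁ b₁ c₁ d₁ bc₁ ih₁)) ⟩
      Y * Y * d₁ * D₁ * (X * a₀ * T) + X * Y * d₀ * D₀ * (X * a₁ * T)
        ≡⟨ e₂ X Y T a₀ a₁ d₀ d₁ D₀ D₁ ⟩
      X * Y * T * (Y * D₁ * (a₀ * d₁) + X * D₀ * (a₁ * d₀))
        ≤⟨ *-monoʳ-≤ (X * Y * T) (rearrangement (*-mono-≤ a₀≤a₁ d₁≤d₀) XD₀≤YD₁) ⟩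
      X * Y * T * (X * D₀ * (a₀ * d₁) + Y * D₁ * (a₁ * d₀))
        ≡⟨ e₃ X Y T a₀ a₁ d₀ d₁ D₀ D₁ ⟩
      X * X * a₀ * D₀ * (Y * d₁ * T) + X * Y * a₁ * D₁ * (Y * d₀ * T)
        ≤⟨ +-mono-≤ (*-monoʳ-≤ (X * X * a₀ * D₀) (cross-lower a₁ b₁ c₁ d₁ bc₁ ih₁))
                    (*-monoʳ-≤ (X * Y * a₁ * D₁) (cross-lower a₀ b₀ c₀ d₀ bc₀ ih₀)) ⟩
      X * X * a₀ * D₀ * (c₁ * D₁) + X * Y * a₁ * D₁ * (c₀ * D₀)
        ≡⟨ e₄ X Y a₀ a₁ c₀ c₁ D₀ D₁ ⟩
      (X * X * (a₀ * c₁) + X * Y * (a₁ * c₀)) * (D₀ * D₁) ∎)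
    where
    D₀ = D a₀ d₀
    D₁ = D a₁ d₁
    DD>0 : 0 < D₀ * D₁
    DD>0 = *-mono-≤ (≤-trans (*-mono-≤ X>0 T′>0) (D-lower ad₀))
                    (≤-trans (*-mono-≤ X>0 T′>0) (D-lower ad₁))
    d₁≤d₀ : d₁ ≤ d₀
    d₁≤d₀ = +-cancelˡ-≤ a₁ d₁ d₀ (begin
      a₁ + d₁  ≡⟨ trans ad₁ (sym ad₀) ⟩
      a₀ + d₀  ≤⟨ +-monoˡ-≤ d₀ a₀≤a₁ ⟩
      a₁ + d₀  ∎)
    XD₀≤YD₁ : X * D₀ ≤ Y * D₁
    XD₀≤YD₁ = begin
      X * D₀        ≤⟨ *-monoʳ-≤ X (D-upper ad₀) ⟩
      X * (Y * T′)  ≡⟨ *-assoc X Y T′ ⟨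
      X * Y * T′    ≡⟨ cong (_* T′) (*-comm X Y) ⟩
      Y * X * T′    ≡⟨ *-assoc Y X T′ ⟩
      Y * (X * T′)  ≤⟨ *-monoʳ-≤ Y (D-lower ad₁) ⟩
      Y * D₁        ∎
    e₁ : ∀ X Y b₀ b₁ d₀ d₁ D₀ D₁ →
         (Y * Y * (b₀ * d₁) + X * Y * (b₁ * d₀)) * (D₀ * D₁)
         ≡ Y * Y * d₁ * D₁ * (b₀ * D₀) + X * Y * d₀ * D₀ * (b₁ * D₁)
    e₁ = solve-∀
    e₂ : ∀ X Y T a₀ a₁ d₀ d₁ D₀ D₁ →
         Y * Y * d₁ * D₁ * (X * a₀ * T) + X * Y * d₀ * D₀ * (X * a₁ * T)
         ≡ X * Y * T * (Y * D₁ * (a₀ * d₁) + X * D₀ * (a₁ * d₀))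
    e₂ = solve-∀
    e₃ : ∀ X Y T a₀ a₁ d₀ d₁ D₀ D₁ →
         X * Y * T * (X * D₀ * (a₀ * d₁) + Y * D₁ * (a₁ * d₀))
         ≡ X * X * a₀ * D₀ * (Y * d₁ * T) + X * Y * a₁ * D₁ * (Y * d₀ * T)
    e₃ = solve-∀
    e₄ : ∀ X Y a₀ a₁ c₀ c₁ D₀ D₁ →
         X * X * a₀ * D₀ * (c₁ * D₁) + X * Y * a₁ * D₁ * (c₀ * D₀)
         ≡ (X * X * (a₀ * c₁) + X * Y * (a₁ * c₀)) * (D₀ * D₁)
    e₄ = solve-∀

^-pos : ∀ {m} k → 0 < m → 0 < m ^ k
^-pos zero    p = s≤s z≤n
^-pos (suc k) p = *-mono-≤ p (^-pos k p)

-- The odds amp α to amp (∁ α), relative to the odds of the arguments, do not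
-- decrease when the latter pass from s to r up to s′ to r′. Splitting on the
-- first argument turns both sides into quadratic forms; the diagonal terms
-- are the induction hypotheses for the two restrictions, and the off-diagonal
-- terms are compared by cross.
odds-ratio : ∀ {k} {α : BoolFun k} → Monotone α →
             ∀ {s r s′ r′} → 0 < s → 0 < r′ → s * r′ ≤ s′ * r →
             amp α s r * amp (∁ α) s′ r′ * (s′ * r) ≤ amp α s′ r′ * amp (∁ α) s r * (s * r′)
odds-ratio {zero} {α} mon s>0 r′>0 le with α []
... | true  = z≤n
... | false = z≤n
odds-ratio {suc k} {α} mon {s} {r} {s′} {r′} s>0 r′>0 le = begin
    (s * b₁ + r * b₀) * (s′ * d₁ + r′ * d₀) * (s′ * r)
      ≡⟨ e₁ s r s′ r′ b₀ b₁ d₀ d₁ ⟩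
    s * s′ * (b₁ * d₁ * Y) + r * r′ * (b₀ * d₀ * Y) + (Y * Y * (b₀ * d₁) + X * Y * (b₁ * d₀))
      ≤⟨ +-mono-≤ (+-mono-≤ (*-monoʳ-≤ (s * s′) ih₁) (*-monoʳ-≤ (r * r′) ih₀))
           (cross le (*-mono-≤ s>0 r′>0) (^-pos k (≤-trans r′>0 (m≤n+m r′ s′)))
             (amp-total α₀ s′ r′) (amp-total α₁ s′ r′) (amp-total α₀ s r) (amp-total α₁ s r)
             (amp-mono (restriction-mono mon) s′ r′) ih₀ ih₁) ⟩
    s * s′ * (a₁ * c₁ * X) + r * r′ * (a₀ * c₀ * X) + (X * X * (a₀ * c₁) + X * Y * (a₁ * c₀))
      ≡⟨ e₂ s r s′ r′ a₀ a₁ c₀ c₁ ⟩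
    (s′ * a₁ + r′ * a₀) * (s * c₁ + r * c₀) * (s * r′) ∎
  where
  open ≤-Reasoning
  α₀ = α ∘ (false ∷_)
  α₁ = α ∘ (true ∷_)
  X = s * r′
  Y = s′ * r
  a₀ = amp α₀ s′ r′
  a₁ = amp α₁ s′ r′
  b₀ = amp α₀ s r
  b₁ = amp α₁ s r
  c₀ = amp (∁ α₀) s r
  c₁ = amp (∁ α₁) s r
  d₀ = amp (∁ α₀) s′ r′
  d₁ = amp (∁ α₁) s′ r′
  ih₀ : b₀ * d₀ * Y ≤ a₀ * c₀ * X
  ih₀ = odds-ratio (∷-monotone mon false) s>0 r′>0 le
  ih₁ : b₁ * d₁ * Y ≤ a₁ * c₁ * X
  ih₁ = odds-ratio (∷-monotone mon true) s>0 r′>0 le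
  e₁ : ∀ s r s′ r′ b₀ b₁ d₀ d₁ →
       (s * b₁ + r * b₀) * (s′ * d₁ + r′ * d₀) * (s′ * r)
       ≡ s * s′ * (b₁ * d₁ * (s′ * r)) + r * r′ * (b₀ * d₀ * (s′ * r))
         + ((s′ * r) * (s′ * r) * (b₀ * d₁) + (s * r′) * (s′ * r) * (b₁ * d₀))
  e₁ = solve-∀
  e₂ : ∀ s r s′ r′ a₀ a₁ c₀ c₁ →
       s * s′ * (a₁ * c₁ * (s * r′)) + r * r′ * (a₀ * c₀ * (s * r′))
         + ((s * r′) * (s * r′) * (a₀ * c₁) + (s * r′) * (s′ * r) * (a₁ * c₀))
       ≡ (s′ * a₁ + r′ * a₀) * (s * c₁ + r * c₀) * (s * r′)
  e₂ = solve-∀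

------------------------------------------------------------------------
-- Fixed points with rational odds

zeros ones : ∀ k → Vec Bool k
zeros k = Vec.replicate k false
ones  k = Vec.replicate k true

-- The input whose only one is at position j.
unit : ∀ {k} → Fin k → Vec Bool k
unit zero    = true ∷ zeros _
unit (suc j) = false ∷ unit j

-- The dual connective, for which the roles of 0 and 1 are exchanged.
dual : ∀ {k} → BoolFun k → BoolFun k
dual α = ∁ α ∘ Vec.map not

false≤ : ∀ {b} → false Bool.≤ b
false≤ {false} = Bool.b≤b
false≤ {true}  = Bool.f≤t

≤true : ∀ {b} → b Bool.≤ true
≤true {false} = Bool.f≤t
≤true {true}  = Bool.b≤b

zeros-least : ∀ {k} (x : Vec Bool k) → Pointwise Bool._≤_ (zeros k) x
zeros-least []      = []
zeros-least (b ∷ x) = false≤ ∷ zeros-least x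

ones-greatest : ∀ {k} (x : Vec Bool k) → Pointwise Bool._≤_ x (ones k)
ones-greatest []      = []
ones-greatest (b ∷ x) = ≤true ∷ ones-greatest x

true-upward : ∀ {b c} → b Bool.≤ c → b ≡ true → c ≡ true
true-upward Bool.b≤b e = e

false-downward : ∀ {b c} → b Bool.≤ c → c ≡ false → b ≡ false
false-downward Bool.b≤b e = e

not-antitone : ∀ {b c} → b Bool.≤ c → not c Bool.≤ not b
not-antitone Bool.f≤t = Bool.f≤t
not-antitone Bool.b≤b = Bool.b≤b

dual-monotone : ∀ {k} {α : BoolFun k} → Monotone α → Monotone (dual α)
dual-monotone mon p = not-antitone (mon (flipped p))
  where
  flipped : ∀ {k} {x y : Vec Bool k} → Pointwise Bool._≤_ x y →
            Pointwise Bool._≤_ (Vec.map not y) (Vec.map not x)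
  flipped []      = []
  flipped (p ∷ q) = not-antitone p ∷ flipped q

amp-dual : ∀ {k} (α : BoolFun k) s r → amp (dual α) r s ≡ amp (∁ α) s r
amp-dual α s r = amp-flip (∁ α) r s

amp-∁-dual : ∀ {k} (α : BoolFun k) s r → amp (∁ (dual α)) r s ≡ amp α s r
amp-∁-dual α s r =
  trans (amp-cong (λ x → Bool.not-involutive (α (Vec.map not x))) r s) (amp-flip α r s)

dual-zeros : ∀ {k} (α : BoolFun k) → dual α (zeros k) ≡ not (α (ones k))
dual-zeros {k} α = cong (not ∘ α) (Vec.map-replicate not false k)

amp-linear : ∀ {k} (α : BoolFun k) → α (zeros k) ≡ false →
             ∀ s r → ∃[ c ] amp α s r ≡ s * c
amp-linear {zero}  α α0 s r rewrite α0 = 0 , sym (*-zeroʳ s)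
amp-linear {suc k} α α0 s r with c , e ← amp-linear (α ∘ (false ∷_)) α0 s r =
  amp α₁ s r + r * c , trans (cong (λ z → s * amp α₁ s r + r * z) e) (regroup s r (amp α₁ s r) c)
  where
  α₁ = α ∘ (true ∷_)
  regroup : ∀ s r a c → s * a + r * (s * c) ≡ s * (a + r * c)
  regroup = solve-∀

-- If α vanishes on all inputs with at most one one, then only monomials with
-- at least two factors s occur.
amp-quadratic : ∀ {k} (α : BoolFun k) → α (zeros k) ≡ false →
                (∀ j → α (unit j) ≡ false) →
                ∀ s r → ∃[ c ] amp α s r ≡ s * s * c
amp-quadratic {zero}  α α0 αe s r rewrite α0 = 0 , sym (*-zeroʳ (s * s))
amp-quadratic {suc k} α α0 αe s r
  with c₁ , e₁ ← amp-linear (α ∘ (true ∷_)) (αe zero) s r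
     | c₀ , e₀ ← amp-quadratic (α ∘ (false ∷_)) α0 (αe ∘ suc) s r
  = c₁ + r * c₀ , trans (cong₂ (λ a b → s * a + r * b) e₁ e₀) (regroup s r c₁ c₀)
  where
  regroup : ∀ s r a b → s * (s * a) + r * (s * s * b) ≡ s * s * (a + r * b)
  regroup = solve-∀

-- Two inequalities whose sum is an equality are equalities.
+-≤-≡ : ∀ {a b c d} → a ≤ c → b ≤ d → a + b ≡ c + d → a ≡ c × b ≡ d
+-≤-≡ {a} {b} {c} {d} a≤c b≤d e = a≡c , +-cancelˡ-≡ c b d (trans (cong (_+ b) (sym a≡c)) e)
  where
  a≡c : a ≡ c
  a≡c = ≤-antisym a≤c (+-cancelʳ-≤ b c a (≤-trans (+-monoʳ-≤ c b≤d) (≤-reflexive (sym e))))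

-- The amplified odds amp α s r to amp (∁ α) s r equal the odds s to r.
Fixed : ∀ {k} → BoolFun k → ℕ → ℕ → Set
Fixed α s r = amp α s r * r ≡ amp (∁ α) s r * s

-- α takes the values 0 and 1 equally often.
Fair : ∀ {k} → BoolFun k → Set
Fair α = amp α 1 1 ≡ amp (∁ α) 1 1

-- A monotone α with value 1 at unit j is at least the j-th projection. Its
-- odds are then at least those of the arguments, and equality at one interior
-- point is possible only if α is that projection.
dominating : ∀ {k} {α : BoolFun k} → Monotone α → ∀ j → α (unit j) ≡ true →
             ∀ {s r} → 0 < s → 0 < r →
             amp (∁ α) s r * s ≤ amp α s r * r × (Fixed α s r → Fair α)
dominating {suc k} {α} mon zero αe {s} {r} s>0 r>0 = bound , balanced
  where
  open ≤-Reasoning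
  α₀ = α ∘ (false ∷_)
  α₁ = α ∘ (true ∷_)
  P₀ = amp α₀ s r
  Q₀ = amp (∁ α₀) s r
  ∁α₁≡false : ∀ x → ∁ α₁ x ≡ false
  ∁α₁≡false x = cong not (true-upward (mon (Bool.≤-refl ∷ zeros-least x)) αe)
  Q₁≡0 : ∀ s r → amp (∁ α₁) s r ≡ 0
  Q₁≡0 = amp-const-false ∁α₁≡false
  P₁≡ : ∀ s r → amp α₁ s r ≡ amp α₀ s r + amp (∁ α₀) s r
  P₁≡ s r = trans (sym (+-identityʳ _))
           (trans (cong (amp α₁ s r +_) (sym (Q₁≡0 s r)))
           (trans (amp-total α₁ s r) (sym (amp-total α₀ s r))))
  -- The restriction of α to first argument 1 is constantly 1, so α exceeds the
  -- first projection exactly by the contribution of α₀.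
  excess : amp α s r * r ≡ amp (∁ α) s r * s + (s * r + r * r) * P₀
  excess rewrite P₁≡ s r | Q₁≡0 s r = e s r P₀ Q₀
    where
    e : ∀ s r p q → (s * (p + q) + r * p) * r ≡ (s * 0 + r * q) * s + (s * r + r * r) * p
    e = solve-∀
  bound = ≤-trans (m≤m+n _ _) (≤-reflexive (sym excess))
  balanced : Fixed α s r → Fair α
  balanced fix = begin-equality
    1 * amp α₁ 1 1 + 1 * amp α₀ 1 1              ≡⟨ cong (λ p → 1 * p + 1 * amp α₀ 1 1) (P₁≡ 1 1) ⟩
    1 * (amp α₀ 1 1 + q₀) + 1 * amp α₀ 1 1       ≡⟨ cong (λ p → 1 * (p + q₀) + 1 * p) p₀≡0 ⟩
    1 * q₀ + 0                                   ≡⟨ +-identityʳ (1 * q₀) ⟩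
    0 + 1 * q₀                                   ≡⟨ cong (λ q → 1 * q + 1 * q₀) (Q₁≡0 1 1) ⟨
    1 * amp (∁ α₁) 1 1 + 1 * q₀                  ∎
    where
    q₀ = amp (∁ α₀) 1 1
    z : (s * r + r * r) * P₀ ≡ 0
    z = +-cancelˡ-≡ (amp (∁ α) s r * s) _ 0 (trans (sym excess) (trans fix (sym (+-identityʳ _))))
    coeff>0 : 0 < s * r + r * r
    coeff>0 = ≤-trans (*-mono-≤ s>0 r>0) (m≤m+n _ _)
    P₀≡0 : P₀ ≡ 0
    P₀≡0 = m*n≡0⇒m≡0 P₀ (s * r + r * r) {{>-nonZero coeff>0}} (trans (*-comm P₀ _) z)
    -- amp α₀ increases with s and r, so it vanishes at 1 and 1 as well.
    p₀≡0 : amp α₀ 1 1 ≡ 0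
    p₀≡0 = n≤0⇒n≡0 (≤-trans (amp-mono-args α₀ s>0 r>0) (≤-reflexive P₀≡0))
dominating {suc k} {α} mon (suc j) αe {s} {r} s>0 r>0
  with b₀ , f₀ ← dominating (∷-monotone mon false) j αe s>0 r>0
     | b₁ , f₁ ← dominating (∷-monotone mon true) j
                   (true-upward (restriction-mono mon (unit j)) αe) s>0 r>0
  = subst₂ _≤_ (sym (split s r Q₁ Q₀ s)) (sym (split s r P₁ P₀ r)) bound , balanced
  where
  α₀ = α ∘ (false ∷_)
  α₁ = α ∘ (true ∷_)
  P₀ = amp α₀ s r
  P₁ = amp α₁ s r
  Q₀ = amp (∁ α₀) s r
  Q₁ = amp (∁ α₁) s r
  split : ∀ s r a b c → (s * a + r * b) * c ≡ s * (a * c) + r * (b * c)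
  split = solve-∀
  bound = +-mono-≤ (*-monoʳ-≤ s b₁) (*-monoʳ-≤ r b₀)
  balanced : Fixed α s r → Fair α
  balanced fix = cong₂ (λ a b → 1 * a + 1 * b) (f₁ eq₁) (f₀ eq₀)
    where
    eqs = +-≤-≡ (*-monoʳ-≤ s b₁) (*-monoʳ-≤ r b₀)
            (trans (sym (split s r Q₁ Q₀ s)) (trans (sym fix) (split s r P₁ P₀ r)))
    eq₁ : P₁ * r ≡ Q₁ * s
    eq₁ = sym (*-cancelˡ-≡ _ _ s {{>-nonZero s>0}} (proj₁ eqs))
    eq₀ : P₀ * r ≡ Q₀ * s
    eq₀ = sym (*-cancelˡ-≡ _ _ r {{>-nonZero r>0}} (proj₂ eqs))

coprime-∣-^ : ∀ {m n} k → Coprime n m → m ∣ n ^ k → m ≡ 1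
coprime-∣-^ zero    c d = ∣1⇒≡1 d
coprime-∣-^ (suc k) c d = coprime-∣-^ k c (Coprimality.coprime-divisor (Coprimality.sym c) d)

-- A fixed point gives amp α s r * (s + r) = (s + r) ^ k * s. Since s * s
-- divides amp α s r, cancelling s shows that s divides (s + r) ^ k, to which
-- it is coprime.
fixed-numerator : ∀ {k} (α : BoolFun k) {s r} → 0 < s → Coprime s r →
                  α (zeros k) ≡ false → (∀ j → α (unit j) ≡ false) →
                  Fixed α s r → s ≡ 1
fixed-numerator {k} α {s} {r} s>0 cop α0 αe fix
  with c , e ← amp-quadratic α α0 αe s r
  = coprime-∣-^ k (Coprimality.coprime-+ (Coprimality.sym cop))
      (divides (c * (s + r)) (*-cancelʳ-≡ _ _ s {{>-nonZero s>0}} total))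
  where
  open ≤-Reasoning
  P = amp α s r
  Q = amp (∁ α) s r
  total : (s + r) ^ k * s ≡ c * (s + r) * s * s
  total = begin-equality
    (s + r) ^ k * s        ≡⟨ cong (_* s) (amp-total α s r) ⟨
    (P + Q) * s            ≡⟨ *-distribʳ-+ s P Q ⟩
    P * s + Q * s          ≡⟨ cong (P * s +_) fix ⟨
    P * s + P * r          ≡⟨ *-distribˡ-+ P s r ⟨
    P * (s + r)            ≡⟨ cong (_* (s + r)) e ⟩
    s * s * c * (s + r)    ≡⟨ regroup s r c ⟩
    c * (s + r) * s * s    ∎
    where
    regroup : ∀ s r c → s * s * c * (s + r) ≡ c * (s + r) * s * s
    regroup = solve-∀

Fixed-dual : ∀ {k} (α : BoolFun k) {s r} → Fixed α s r → Fixed (dual α) r s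
Fixed-dual α {s} {r} fix =
  trans (cong (_* s) (amp-dual α s r)) (trans (sym fix) (cong (_* r) (sym (amp-∁-dual α s r))))

Fair-undual : ∀ {k} (α : BoolFun k) → Fair (dual α) → Fair α
Fair-undual α fair = trans (sym (amp-∁-dual α 1 1)) (trans (sym fair) (amp-dual α 1 1))

Fixed-reduce : ∀ {k} (α : BoolFun k) g {s r} → 0 < g → Fixed α (g * s) (g * r) → Fixed α s r
Fixed-reduce {k} α g {s} {r} g>0 fix =
  *-cancelʳ-≡ _ _ (g ^ k * g) {{>-nonZero (*-mono-≤ (^-pos k g>0) g>0)}}
    (trans (regroup (g ^ k) g (amp α s r) r)
    (trans (trans (trans (cong (_* (g * r)) (sym (amp-homogeneous α g s r))) fix)
                  (cong (_* (g * s)) (amp-homogeneous (∁ α) g s r)))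
           (sym (regroup (g ^ k) g (amp (∁ α) s r) s))))
  where
  regroup : ∀ t g a b → a * b * (t * g) ≡ t * a * (g * b)
  regroup = solve-∀

lowest-terms : ∀ {s} r → 0 < s →
  ∃[ g ] ∃[ s′ ] ∃[ r′ ] (0 < g × s ≡ g * s′ × r ≡ g * r′ × Coprime s′ r′)
lowest-terms {s} r s>0 =
  g , s / g , r / g , n≢0⇒n>0 g≢0 ,
  sym (m*[n/m]≡n (gcd[m,n]∣m s r)) ,
  sym (m*[n/m]≡n (gcd[m,n]∣n s r)) ,
  Coprimality.coprime-/gcd s r
  where
  g = gcd s r
  g≢0 : g ≢ 0
  g≢0 = gcd[m,n]≢0 s r (inj₁ (n>0⇒n≢0 s>0))
  instance
    _ : NonZero g
    _ = ≢-nonZero g≢0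

positive-factor : ∀ g {m n} → 0 < m → m ≡ g * n → 0 < n
positive-factor g {n = zero}  m>0 e = contradiction (trans e (*-zeroʳ g)) (n>0⇒n≢0 m>0)
positive-factor g {n = suc n} m>0 e = s≤s z≤n

fixed⇒balanced : ∀ {k} {α : BoolFun k} → Monotone α →
                 α (zeros k) ≡ false → α (ones k) ≡ true →
                 ∀ {s r} → 0 < s → 0 < r → Fixed α s r → Fair α
fixed⇒balanced {k} {α} mon α0 α1 {s} {r} s>0 r>0 fix
  with Fin.any? (λ j → α (unit j) Bool.≟ true)
     | Fin.any? (λ j → dual α (unit j) Bool.≟ true)
     | lowest-terms r s>0
... | yes (j , αe) | _ | _ = proj₂ (dominating mon j αe s>0 r>0) fix
... | no _ | yes (j , αe) | _ =
  Fair-undual α (proj₂ (dominating (dual-monotone mon) j αe r>0 s>0) (Fixed-dual α fix))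
... | no ¬αe | no ¬βe | g , s′ , r′ , g>0 , refl , refl , cop =
  *-cancelʳ-≡ _ _ 1 (subst₂ (Fixed α) s′≡1 r′≡1 fix′)
  where
  fix′ : Fixed α s′ r′
  fix′ = Fixed-reduce α g g>0 fix
  s′≡1 : s′ ≡ 1
  s′≡1 = fixed-numerator α (positive-factor g s>0 refl) cop α0
           (λ j → Bool.¬-not (λ e → ¬αe (j , e))) fix′
  r′≡1 : r′ ≡ 1
  r′≡1 = fixed-numerator (dual α) (positive-factor g r>0 refl) (Coprimality.sym cop)
           (trans (dual-zeros α) (cong not α1))
           (λ j → Bool.¬-not (λ e → ¬βe (j , e))) (Fixed-dual α fix′)

------------------------------------------------------------------------
-- Convergence of the iterated amplification

-- The share of u in u + v tends to 0, at least as fast as C/i. This rate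
-- stands in for convergence because it is stated without division and is all
-- that the limit requires.
Vanishes : (u v : ℕ → ℕ) → Set
Vanishes u v = ∃[ C ] (∀ i → u i * i ≤ C * (u i + v i))

-- If each step that starts from odds u to v not above the initial ones shrinks
-- them by the factor a/b < 1, then the odds never exceed the initial ones, and
-- decay geometrically. The rate is weakened to a/(a+i), which is simpler to
-- state; the step uses a * (a + i + 1) ≤ b * (a + i).
harmonic-decay : ∀ {a b} {u v : ℕ → ℕ} → 0 < a → a < b → (∀ i → 0 < v i) →
  (∀ i → u i * v 0 ≤ u 0 * v i → u (suc i) * b * v i ≤ a * v (suc i) * u i) →
  ∀ i → u i * (a + i) * v 0 ≤ a * u 0 * v i
harmonic-decay {a} {b} {u} {v} a>0 a<b v>0 step zero =
  ≤-reflexive (e a (u 0) (v 0))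
  where
  e : ∀ a x y → x * (a + 0) * y ≡ a * x * y
  e = solve-∀
harmonic-decay {a} {b} {u} {v} a>0 a<b v>0 step (suc i) =
  *-cancelʳ-≤ _ _ (a * v i) {{>-nonZero (*-mono-≤ a>0 (v>0 i))}} (begin
    u′ * (a + suc i) * v₀ * (a * vᵢ)            ≡⟨ e₁ a i u′ v₀ vᵢ ⟩
    u′ * v₀ * vᵢ * (a * (a + suc i))            ≤⟨ *-monoʳ-≤ (u′ * v₀ * vᵢ) slack ⟩
    u′ * v₀ * vᵢ * (suc a * (a + i))            ≤⟨ *-monoʳ-≤ (u′ * v₀ * vᵢ) (*-monoˡ-≤ (a + i) a<b) ⟩
    u′ * v₀ * vᵢ * (b * (a + i))                ≡⟨ e₂ a b i u′ v₀ vᵢ ⟩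
    u′ * b * vᵢ * ((a + i) * v₀)                ≤⟨ *-monoˡ-≤ ((a + i) * v₀) (step i odds) ⟩
    a * v′ * uᵢ * ((a + i) * v₀)                ≡⟨ e₃ a i uᵢ v₀ v′ ⟩
    a * v′ * (uᵢ * (a + i) * v₀)                ≤⟨ *-monoʳ-≤ (a * v′) ih ⟩
    a * v′ * (a * u 0 * vᵢ)                     ≡⟨ e₄ a (u 0) vᵢ v′ ⟩
    a * u 0 * v′ * (a * vᵢ)                     ∎)
  where
  open ≤-Reasoning
  u′ = u (suc i)
  v′ = v (suc i)
  uᵢ = u i
  vᵢ = v i
  v₀ = v 0
  ih : uᵢ * (a + i) * v₀ ≤ a * u 0 * vᵢ
  ih = harmonic-decay a>0 a<b v>0 step i
  odds : uᵢ * v₀ ≤ u 0 * vᵢ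
  odds = *-cancelˡ-≤ a {{>-nonZero a>0}} (begin
    a * (uᵢ * v₀)        ≡⟨ trans (*-comm a _) (trans (*-assoc uᵢ v₀ a) (trans (cong (uᵢ *_) (*-comm v₀ a)) (sym (*-assoc uᵢ a v₀)))) ⟩
    uᵢ * a * v₀          ≤⟨ *-monoˡ-≤ v₀ (*-monoʳ-≤ uᵢ (m≤m+n a i)) ⟩
    uᵢ * (a + i) * v₀    ≤⟨ ih ⟩
    a * u 0 * vᵢ         ≡⟨ *-assoc a (u 0) vᵢ ⟩
    a * (u 0 * vᵢ)       ∎)
  slack : a * (a + suc i) ≤ suc a * (a + i)
  slack = ≤-trans (m≤m+n _ i) (≤-reflexive (e a i))
    where
    e : ∀ a i → a * (a + (1 + i)) + i ≡ (1 + a) * (a + i)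
    e = solve-∀
  e₁ : ∀ a i u′ v₀ vᵢ → u′ * (a + (1 + i)) * v₀ * (a * vᵢ) ≡ u′ * v₀ * vᵢ * (a * (a + (1 + i)))
  e₁ = solve-∀
  e₂ : ∀ a b i u′ v₀ vᵢ → u′ * v₀ * vᵢ * (b * (a + i)) ≡ u′ * b * vᵢ * ((a + i) * v₀)
  e₂ = solve-∀
  e₃ : ∀ a i uᵢ v₀ v′ → a * v′ * uᵢ * ((a + i) * v₀) ≡ a * v′ * (uᵢ * (a + i) * v₀)
  e₃ = solve-∀
  e₄ : ∀ a u₀ vᵢ v′ → a * v′ * (a * u₀ * vᵢ) ≡ a * u₀ * v′ * (a * vᵢ)
  e₄ = solve-∀

decay⇒vanishes : ∀ {a b} {u v : ℕ → ℕ} → 0 < a → a < b → (∀ i → 0 < v i) →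
  (∀ i → u i * v 0 ≤ u 0 * v i → u (suc i) * b * v i ≤ a * v (suc i) * u i) →
  Vanishes u v
decay⇒vanishes {a} {b} {u} {v} a>0 a<b v>0 step = a * u 0 , λ i → begin
  u i * i                  ≤⟨ *-monoʳ-≤ (u i) (m≤n+m i a) ⟩
  u i * (a + i)            ≤⟨ m≤m*n _ (v 0) {{>-nonZero (v>0 0)}} ⟩
  u i * (a + i) * v 0      ≤⟨ harmonic-decay a>0 a<b v>0 step i ⟩
  a * u 0 * v i            ≤⟨ *-monoʳ-≤ (a * u 0) (m≤n+m (v i) (u i)) ⟩
  a * u 0 * (u i + v i)    ∎
  where open ≤-Reasoning

zero⇒vanishes : ∀ (u v : ℕ → ℕ) → (∀ i → u (suc i) ≡ 0) → Vanishes u v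
zero⇒vanishes u v u≡0 = 0 , λ { zero → ≤-reflexive (*-zeroʳ (u 0))
                              ; (suc i) → ≤-reflexive (cong (_* suc i) (u≡0 i)) }

-- For monotone α, the condition on the odds s to r under which the iterates
-- tend to 1: either α is constantly 1, or it is not constantly 0 and the odds
-- are infinite or grow in the first step.
Rises : ∀ {k} → BoolFun k → ℕ → ℕ → Set
Rises {k} α s r = α (zeros k) ≡ true ⊎
  (α (ones k) ≡ true × (r ≡ 0 ⊎ amp (∁ α) s r * s < amp α s r * r))

rises? : ∀ {k} (α : BoolFun k) s r → Dec (Rises α s r)
rises? {k} α s r = (α (zeros k) Bool.≟ true) ⊎-dec
  ((α (ones k) Bool.≟ true) ×-dec
    ((r ≟ 0) ⊎-dec (amp (∁ α) s r * s <? amp α s r * r)))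

amp-no-ones : ∀ {k} (α : BoolFun k) → α (zeros k) ≡ false → ∀ r → amp α 0 r ≡ 0
amp-no-ones α α0 r = proj₂ (amp-linear α α0 0 r)

amp-no-zeros : ∀ {k} (α : BoolFun k) → α (ones k) ≡ false → ∀ s → amp α s 0 ≡ 0
amp-no-zeros {k} α α1 s =
  trans (sym (amp-flip α 0 s))
        (amp-no-ones (α ∘ Vec.map not) (trans (cong α (Vec.map-replicate not false k)) α1) s)

constant-true : ∀ {k} {α : BoolFun k} → Monotone α → α (zeros k) ≡ true → ∀ x → α x ≡ true
constant-true mon α0 x = true-upward (mon (zeros-least x)) α0

constant-false : ∀ {k} {α : BoolFun k} → Monotone α → α (ones k) ≡ false → ∀ x → α x ≡ false
constant-false mon α1 x = false-downward (mon (ones-greatest x)) α1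

-- By odds-ratio, odds that grow in the first step also do so from any larger
-- starting point.
Rises-monotone : ∀ {k} {α : BoolFun k} → Monotone α →
                 ∀ {s r s′ r′} → s ≤ s′ → r′ ≤ r → Rises α s r → Rises α s′ r′
Rises-monotone mon s≤s′ r′≤r (inj₁ α0) = inj₁ α0
Rises-monotone mon s≤s′ r′≤r (inj₂ (α1 , inj₁ refl)) = inj₂ (α1 , inj₁ (n≤0⇒n≡0 r′≤r))
Rises-monotone mon {s} {r} {s′} {zero} s≤s′ r′≤r (inj₂ (α1 , inj₂ up)) = inj₂ (α1 , inj₁ refl)
Rises-monotone {k} {α} mon {s} {r} {s′} {r′@(suc _)} s≤s′ r′≤r (inj₂ (α1 , inj₂ up))
  with α (zeros k) in α0
... | true  = inj₁ refl
... | false = inj₂ (α1 , inj₂ (*-cancelˡ-< (Q * s) _ _ (begin-strict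
    Q * s * (Q′ * s′)        <⟨ *-monoˡ-< (Q′ * s′) {{>-nonZero Q′s′>0}} up ⟩
    P * r * (Q′ * s′)        ≡⟨ e₁ P Q′ r s′ ⟩
    P * Q′ * (s′ * r)        ≤⟨ odds-ratio mon s>0 (s≤s z≤n) (*-mono-≤ s≤s′ r′≤r) ⟩
    P′ * Q * (s * r′)        ≡⟨ e₂ P′ Q s r′ ⟩
    Q * s * (P′ * r′)        ∎)))
  where
  open ≤-Reasoning
  P = amp α s r
  Q = amp (∁ α) s r
  P′ = amp α s′ r′
  Q′ = amp (∁ α) s′ r′
  s>0 : 0 < s
  s>0 = n≢0⇒n>0 λ { refl → contradiction (subst (λ z → Q * 0 < z * r) (amp-no-ones α α0 r) up) λ () }
  Q′s′>0 : 0 < Q′ * s′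
  Q′s′>0 = *-mono-≤ (amp-pos (∁ α) (zeros k) (cong not α0) (≤-trans s>0 s≤s′) (s≤s z≤n))
                    (≤-trans s>0 s≤s′)
  e₁ : ∀ P Q′ r s′ → P * r * (Q′ * s′) ≡ P * Q′ * (s′ * r)
  e₁ = solve-∀
  e₂ : ∀ P′ Q s r′ → P′ * Q * (s * r′) ≡ Q * s * (P′ * r′)
  e₂ = solve-∀

-- The iterated amplification of the odds u 0 to v 0.
module Orbit {k} {α : BoolFun k} (mon : Monotone α) (unbalanced : ¬ Fair α)
             {u v : ℕ → ℕ} (u-step : ∀ i → u (suc i) ≡ amp α (u i) (v i))
             (v-step : ∀ i → v (suc i) ≡ amp (∁ α) (u i) (v i)) where
  open ≤-Reasoning

  -- The case of a nonconstant α and odds that are neither zero nor infinite.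
  -- Here odds-ratio compares each step with the first one, whose ratio of odds
  -- serves as the factor of decay.
  module Interior (α0 : α (zeros k) ≡ false) (α1 : α (ones k) ≡ true)
                  (u₀>0 : 0 < u 0) (v₀>0 : 0 < v 0) where

    P₀ = amp α (u 0) (v 0)
    Q₀ = amp (∁ α) (u 0) (v 0)

    positive : ∀ i → 0 < u i × 0 < v i
    positive zero    = u₀>0 , v₀>0
    positive (suc i) with u>0 , v>0 ← positive i rewrite u-step i | v-step i =
      amp-pos α (ones k) α1 u>0 v>0 , amp-pos (∁ α) (zeros k) (cong not α0) u>0 v>0

    P₀v₀>0 : 0 < P₀ * v 0
    P₀v₀>0 = *-mono-≤ (amp-pos α (ones k) α1 u₀>0 v₀>0) v₀>0

    Q₀u₀>0 : 0 < Q₀ * u 0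
    Q₀u₀>0 = *-mono-≤ (amp-pos (∁ α) (zeros k) (cong not α0) u₀>0 v₀>0) u₀>0

    falling : P₀ * v 0 < Q₀ * u 0 → Vanishes u v
    falling down = decay⇒vanishes P₀v₀>0 down (proj₂ ∘ positive) step
      where
      step : ∀ i → u i * v 0 ≤ u 0 * v i →
             u (suc i) * (Q₀ * u 0) * v i ≤ P₀ * v 0 * v (suc i) * u i
      step i odds rewrite u-step i | v-step i = begin
        P * (Q₀ * u 0) * v i        ≡⟨ e₁ P Q₀ (u 0) (v i) ⟩
        P * Q₀ * (u 0 * v i)        ≤⟨ odds-ratio mon (proj₁ (positive i)) v₀>0 odds ⟩
        P₀ * Q * (u i * v 0)        ≡⟨ e₂ P₀ Q (u i) (v 0) ⟩
        P₀ * v 0 * Q * u i          ∎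
        where
        P = amp α (u i) (v i)
        Q = amp (∁ α) (u i) (v i)
        e₁ : ∀ P Q₀ u₀ vᵢ → P * (Q₀ * u₀) * vᵢ ≡ P * Q₀ * (u₀ * vᵢ)
        e₁ = solve-∀
        e₂ : ∀ P₀ Q uᵢ v₀ → P₀ * Q * (uᵢ * v₀) ≡ P₀ * v₀ * Q * uᵢ
        e₂ = solve-∀

    rising : Q₀ * u 0 < P₀ * v 0 → Vanishes v u
    rising up = decay⇒vanishes Q₀u₀>0 up (proj₁ ∘ positive) step
      where
      step : ∀ i → v i * u 0 ≤ v 0 * u i →
             v (suc i) * (P₀ * v 0) * u i ≤ Q₀ * u 0 * u (suc i) * v i
      step i odds rewrite u-step i | v-step i = begin
        Q * (P₀ * v 0) * u i        ≡⟨ e₁ Q P₀ (v 0) (u i) ⟩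
        P₀ * Q * (u i * v 0)        ≤⟨ odds-ratio mon u₀>0 (proj₂ (positive i))
                                         (subst₂ _≤_ (*-comm (v i) (u 0)) (*-comm (v 0) (u i)) odds) ⟩
        P * Q₀ * (u 0 * v i)        ≡⟨ e₂ P Q₀ (u 0) (v i) ⟩
        Q₀ * u 0 * P * v i          ∎
        where
        P = amp α (u i) (v i)
        Q = amp (∁ α) (u i) (v i)
        e₁ : ∀ Q P₀ v₀ uᵢ → Q * (P₀ * v₀) * uᵢ ≡ P₀ * Q * (uᵢ * v₀)
        e₁ = solve-∀
        e₂ : ∀ P Q₀ u₀ vᵢ → P * Q₀ * (u₀ * vᵢ) ≡ Q₀ * u₀ * P * vᵢ
        e₂ = solve-∀

  stays-0 : α (zeros k) ≡ false → u 0 ≡ 0 → ∀ i → u i ≡ 0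
  stays-0 α0 u₀≡0 zero    = u₀≡0
  stays-0 α0 u₀≡0 (suc i) =
    trans (u-step i) (trans (cong (λ z → amp α z (v i)) (stays-0 α0 u₀≡0 i)) (amp-no-ones α α0 (v i)))

  stays-1 : α (ones k) ≡ true → v 0 ≡ 0 → ∀ i → v i ≡ 0
  stays-1 α1 v₀≡0 zero    = v₀≡0
  stays-1 α1 v₀≡0 (suc i) =
    trans (v-step i) (trans (cong (amp (∁ α) (u i)) (stays-1 α1 v₀≡0 i))
                            (amp-no-zeros (∁ α) (cong not α1) (u i)))

  rises⇒vanishes : Rises α (u 0) (v 0) → Vanishes v u
  rises⇒vanishes (inj₁ α0) = zero⇒vanishes v u λ i →
    trans (v-step i) (amp-const-false (cong not ∘ constant-true mon α0) (u i) (v i))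
  rises⇒vanishes (inj₂ (α1 , inj₁ v₀≡0)) = zero⇒vanishes v u (stays-1 α1 v₀≡0 ∘ suc)
  rises⇒vanishes (inj₂ (α1 , inj₂ up)) with α (zeros k) in α0 | u 0 ≟ 0 | v 0 ≟ 0
  ... | true  | _ | _ = rises⇒vanishes (inj₁ α0)
  ... | false | _ | yes v₀≡0 = zero⇒vanishes v u (stays-1 α1 v₀≡0 ∘ suc)
  ... | false | yes u₀≡0 | no _ rewrite u₀≡0 | amp-no-ones α α0 (v 0) = contradiction up λ ()
  ... | false | no u₀≢0 | no v₀≢0 = Interior.rising α0 α1 (n≢0⇒n>0 u₀≢0) (n≢0⇒n>0 v₀≢0) up

  ¬rises⇒vanishes : ¬ Rises α (u 0) (v 0) → Vanishes u v
  ¬rises⇒vanishes ¬rises with α (zeros k) in α0 | α (ones k) in α1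
  ... | true  | _     = contradiction (inj₁ refl) ¬rises
  ... | false | false = zero⇒vanishes u v λ i →
    trans (u-step i) (amp-const-false (constant-false mon α1) (u i) (v i))
  ... | false | true with u 0 ≟ 0 | v 0 ≟ 0
  ...   | yes u₀≡0 | _ = zero⇒vanishes u v (stays-0 α0 u₀≡0 ∘ suc)
  ...   | no _     | yes v₀≡0 = contradiction (inj₂ (refl , inj₁ v₀≡0)) ¬rises
  ...   | no u₀≢0  | no v₀≢0 with <-cmp (amp α (u 0) (v 0) * v 0) (amp (∁ α) (u 0) (v 0) * u 0)
  ...     | tri< down _ _ = Interior.falling α0 α1 (n≢0⇒n>0 u₀≢0) (n≢0⇒n>0 v₀≢0) down
  ...     | tri≈ _ fix _  = contradiction
              (fixed⇒balanced mon α0 α1 (n≢0⇒n>0 u₀≢0) (n≢0⇒n>0 v₀≢0) fix) unbalanced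
  ...     | tri> _ _ up   = contradiction (inj₂ (refl , inj₂ up)) ¬rises

------------------------------------------------------------------------
-- Finite sums of natural numbers

-- The sum of f over the entries of xs, counted with multiplicity.
∑ : List A → (A → ℕ) → ℕ
∑ xs f = ListAction.sum (List.map f xs)

∑-cong-All : ∀ {xs : List A} {f g : A → ℕ} → All (λ x → f x ≡ g x) xs → ∑ xs f ≡ ∑ xs g
∑-cong-All []       = refl
∑-cong-All (e ∷ es) = cong₂ _+_ e (∑-cong-All es)

∑-cong : ∀ (xs : List A) {f g : A → ℕ} → (∀ x → f x ≡ g x) → ∑ xs f ≡ ∑ xs g
∑-cong xs e = cong ListAction.sum (List.map-cong e xs)

∑-mono : ∀ (xs : List A) {f g : A → ℕ} → (∀ x → f x ≤ g x) → ∑ xs f ≤ ∑ xs g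
∑-mono []       h = z≤n
∑-mono (x ∷ xs) h = +-mono-≤ (h x) (∑-mono xs h)

∑-distrib-+ : ∀ (xs : List A) (f g : A → ℕ) → ∑ xs (λ x → f x + g x) ≡ ∑ xs f + ∑ xs g
∑-distrib-+ []       f g = refl
∑-distrib-+ (x ∷ xs) f g =
  trans (cong (f x + g x +_) (∑-distrib-+ xs f g)) (interchange (f x) (g x) (∑ xs f) (∑ xs g))
  where
  interchange : ∀ a b c d → a + b + (c + d) ≡ a + c + (b + d)
  interchange = solve-∀

∑-distribˡ-* : ∀ (xs : List A) c (f : A → ℕ) → ∑ xs (λ x → c * f x) ≡ c * ∑ xs f
∑-distribˡ-* []       c f = sym (*-zeroʳ c)
∑-distribˡ-* (x ∷ xs) c f =
  trans (cong (c * f x +_) (∑-distribˡ-* xs c f)) (sym (*-distribˡ-+ c (f x) (∑ xs f)))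

∑-distribʳ-* : ∀ (xs : List A) c (f : A → ℕ) → ∑ xs (λ x → f x * c) ≡ ∑ xs f * c
∑-distribʳ-* xs c f =
  trans (∑-cong xs (λ x → *-comm (f x) c)) (trans (∑-distribˡ-* xs c f) (*-comm c (∑ xs f)))

∑-zero : ∀ (xs : List A) → ∑ xs (const 0) ≡ 0
∑-zero []       = refl
∑-zero (x ∷ xs) = ∑-zero xs

∑-one : ∀ (xs : List A) → ∑ xs (const 1) ≡ length xs
∑-one []       = refl
∑-one (x ∷ xs) = cong suc (∑-one xs)

∑-++ : ∀ (xs ys : List A) f → ∑ (xs ++ ys) f ≡ ∑ xs f + ∑ ys f
∑-++ xs ys f = trans (cong ListAction.sum (List.map-++ f xs ys)) (ListAction.sum-++ (List.map f xs) _)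

∑-map : ∀ (h : A → B) (xs : List A) f → ∑ (List.map h xs) f ≡ ∑ xs (f ∘ h)
∑-map h xs f = cong ListAction.sum (sym (List.map-∘ xs))

∑-swap : ∀ (xs : List A) (ys : List B) (f : A → B → ℕ) →
         ∑ xs (λ x → ∑ ys (f x)) ≡ ∑ ys (λ y → ∑ xs (λ x → f x y))
∑-swap []       ys f = sym (∑-zero ys)
∑-swap (x ∷ xs) ys f =
  trans (cong (∑ ys (f x) +_) (∑-swap xs ys f)) (sym (∑-distrib-+ ys (f x) _))

∑-cartesian : ∀ (h : A → B → C) xs ys f →
              ∑ (cartesianProductWith h xs ys) f ≡ ∑ xs (λ x → ∑ ys (λ y → f (h x y)))
∑-cartesian h []       ys f = refl
∑-cartesian h (x ∷ xs) ys f =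
  trans (∑-++ (List.map (h x) ys) _ f)
        (cong₂ _+_ (∑-map (h x) ys f) (∑-cartesian h xs ys f))

∑-allFin-suc : ∀ {n} (f : Fin (suc n) → ℕ) →
               ∑ (allFin (suc n)) f ≡ f zero + ∑ (allFin n) (f ∘ suc)
∑-allFin-suc {n} f =
  cong (f zero +_) (trans (cong (λ is → ∑ is f) (sym (List.map-tabulate id suc)))
                          (∑-map suc (allFin n) f))

------------------------------------------------------------------------
-- Sums over Boolean functions

-- φ depends only on the values of its argument.
Respects≗ : ∀ {n} → (BoolFun n → A) → Set
Respects≗ φ = ∀ {f g} → f ≗ g → φ f ≡ φ g

⟦∧⟧ : ∀ b c → ⟦ b ∧ c ⟧ ≡ ⟦ b ⟧ * ⟦ c ⟧
⟦∧⟧ true  c = sym (+-identityʳ ⟦ c ⟧)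
⟦∧⟧ false c = refl

⟦⟧+⟦not⟧ : ∀ b → ⟦ b ⟧ + ⟦ not b ⟧ ≡ 1
⟦⟧+⟦not⟧ true  = refl
⟦⟧+⟦not⟧ false = refl

branch-η : ∀ {n} (h : BoolFun (suc n)) → branch (h ∘ (false ∷_)) (h ∘ (true ∷_)) ≗ h
branch-η h (false ∷ x) = refl
branch-η h (true ∷ x)  = refl

branch-cong : ∀ {n} {f₀ g₀ f₁ g₁ : BoolFun n} → f₀ ≗ g₀ → f₁ ≗ g₁ → branch f₀ f₁ ≗ branch g₀ g₁
branch-cong e₀ e₁ (false ∷ x) = e₀ x
branch-cong e₀ e₁ (true ∷ x)  = e₁ x

-- As every function is pointwise equal to exactly one entry of allFuns n, the
-- sum of φ restricted to the entries equal to h is φ h.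
∑-allFuns-select : ∀ {n} (h : BoolFun n) {φ : BoolFun n → ℕ} → Respects≗ φ →
                   ∑ (allFuns n) (λ f → ⟦ does (h ≗? f) ⟧ * φ f) ≡ φ h
∑-allFuns-select {zero} h {φ} resp with h [] in e
... | true  = trans (+-identityʳ _) (trans (+-identityʳ _) (resp λ { [] → sym e }))
... | false = trans (+-identityʳ _) (trans (+-identityʳ _) (resp λ { [] → sym e }))
∑-allFuns-select {suc n} h {φ} resp = begin
  ∑ (allFuns (suc n)) (λ f → ⟦ does (h ≗? f) ⟧ * φ f)
    ≡⟨ ∑-cartesian branch (allFuns n) (allFuns n) _ ⟩
  ∑ (allFuns n) (λ f₀ → ∑ (allFuns n) (λ f₁ → ⟦ does (h₀ ≗? f₀) ∧ does (h₁ ≗? f₁) ⟧ * φ (branch f₀ f₁)))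
    ≡⟨ ∑-cong (allFuns n) (λ f₀ → begin
         ∑ (allFuns n) (λ f₁ → ⟦ does (h₀ ≗? f₀) ∧ does (h₁ ≗? f₁) ⟧ * φ (branch f₀ f₁))
           ≡⟨ ∑-cong (allFuns n) (λ f₁ → trans
                (cong (_* φ (branch f₀ f₁)) (⟦∧⟧ (does (h₀ ≗? f₀)) (does (h₁ ≗? f₁))))
                (*-assoc ⟦ does (h₀ ≗? f₀) ⟧ ⟦ does (h₁ ≗? f₁) ⟧ (φ (branch f₀ f₁)))) ⟩
         ∑ (allFuns n) (λ f₁ → ⟦ does (h₀ ≗? f₀) ⟧ * (⟦ does (h₁ ≗? f₁) ⟧ * φ (branch f₀ f₁)))
           ≡⟨ ∑-distribˡ-* (allFuns n) ⟦ does (h₀ ≗? f₀) ⟧ _ ⟩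
         ⟦ does (h₀ ≗? f₀) ⟧ * ∑ (allFuns n) (λ f₁ → ⟦ does (h₁ ≗? f₁) ⟧ * φ (branch f₀ f₁))
           ≡⟨ cong (⟦ does (h₀ ≗? f₀) ⟧ *_)
                (∑-allFuns-select h₁ (λ e → resp (branch-cong (λ _ → refl) e))) ⟩
         ⟦ does (h₀ ≗? f₀) ⟧ * φ (branch f₀ h₁) ∎) ⟩
  ∑ (allFuns n) (λ f₀ → ⟦ does (h₀ ≗? f₀) ⟧ * φ (branch f₀ h₁))
    ≡⟨ ∑-allFuns-select h₀ (λ e → resp (branch-cong e (λ _ → refl))) ⟩
  φ (branch h₀ h₁)
    ≡⟨ resp (branch-η h) ⟩
  φ h ∎
  where
  open ≡-Reasoning
  h₀ = h ∘ (false ∷_)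
  h₁ = h ∘ (true ∷_)

-- A union bound: functions that differ do so at some input.
⟦not-≗?⟧≤ : ∀ {n} (f g : BoolFun n) →
            ⟦ not (does (f ≗? g)) ⟧ ≤ ∑ (inputs n) (λ x → ⟦ f x xor g x ⟧)
⟦not-≗?⟧≤ {zero} f g with f [] | g []
... | true  | true  = z≤n
... | true  | false = ≤-refl
... | false | true  = ≤-refl
... | false | false = z≤n
⟦not-≗?⟧≤ {suc n} f g = begin
  ⟦ not (does (f₀ ≗? g₀) ∧ does (f₁ ≗? g₁)) ⟧
    ≤⟨ union (does (f₀ ≗? g₀)) (does (f₁ ≗? g₁)) ⟩
  ⟦ not (does (f₀ ≗? g₀)) ⟧ + (⟦ not (does (f₁ ≗? g₁)) ⟧ + 0)
    ≤⟨ +-mono-≤ (⟦not-≗?⟧≤ f₀ g₀) (+-monoˡ-≤ 0 (⟦not-≗?⟧≤ f₁ g₁)) ⟩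
  ∑ (false ∷ true ∷ []) (λ b → ∑ (inputs n) (λ x → ⟦ f (b ∷ x) xor g (b ∷ x) ⟧))
    ≡⟨ ∑-cartesian _∷_ (false ∷ true ∷ []) (inputs n) _ ⟨
  ∑ (inputs (suc n)) (λ x → ⟦ f x xor g x ⟧) ∎
  where
  open ≤-Reasoning
  f₀ = f ∘ (false ∷_)
  f₁ = f ∘ (true ∷_)
  g₀ = g ∘ (false ∷_)
  g₁ = g ∘ (true ∷_)
  union : ∀ b c → ⟦ not (b ∧ c) ⟧ ≤ ⟦ not b ⟧ + (⟦ not c ⟧ + 0)
  union true  true  = z≤n
  union true  false = s≤s z≤n
  union false c     = s≤s z≤n

------------------------------------------------------------------------
-- One growth step on integer weights

-- The integral of φ against m, that is, the expectation of φ scaled by the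
-- total of the weights m.
E : ∀ {n} → (BoolFun n → ℕ) → (BoolFun n → ℕ) → ℕ
E {n} m φ = ∑ (allFuns n) (λ f → m f * φ f)

-- The weight of a tuple of independent draws with weights m.
weightProduct : ∀ {k} → (A → ℕ) → Vec A k → ℕ
weightProduct m gs = Vec.foldr′ _*_ 1 (Vec.map m gs)

-- The growth step grow, for weights in the natural numbers.
growWeights : ∀ {k n} → BoolFun k → (BoolFun n → ℕ) → BoolFun n → ℕ
growWeights {k} {n} α m f =
  ∑ (tuples k (allFuns n)) (λ gs → ⟦ does (compose α gs ≗? f) ⟧ * weightProduct m gs)

E-growWeights : ∀ {k n} (α : BoolFun k) (m : BoolFun n → ℕ) {φ} → Respects≗ φ →
  E (growWeights α m) φ ≡ ∑ (tuples k (allFuns n)) (λ gs → weightProduct m gs * φ (compose α gs))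
E-growWeights {k} {n} α m {φ} resp = begin
  ∑ (allFuns n) (λ f → ∑ ts (λ gs → δ gs f * weightProduct m gs) * φ f)
    ≡⟨ ∑-cong (allFuns n) (λ f → sym (∑-distribʳ-* ts (φ f) _)) ⟩
  ∑ (allFuns n) (λ f → ∑ ts (λ gs → δ gs f * weightProduct m gs * φ f))
    ≡⟨ ∑-swap (allFuns n) ts _ ⟩
  ∑ ts (λ gs → ∑ (allFuns n) (λ f → δ gs f * weightProduct m gs * φ f))
    ≡⟨ ∑-cong ts (λ gs → begin
         ∑ (allFuns n) (λ f → δ gs f * weightProduct m gs * φ f)
           ≡⟨ ∑-cong (allFuns n) (λ f → regroup (δ gs f) (weightProduct m gs) (φ f)) ⟩
         ∑ (allFuns n) (λ f → weightProduct m gs * (δ gs f * φ f))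
           ≡⟨ ∑-distribˡ-* (allFuns n) (weightProduct m gs) _ ⟩
         weightProduct m gs * ∑ (allFuns n) (λ f → δ gs f * φ f)
           ≡⟨ cong (weightProduct m gs *_) (∑-allFuns-select (compose α gs) resp) ⟩
         weightProduct m gs * φ (compose α gs) ∎) ⟩
  ∑ ts (λ gs → weightProduct m gs * φ (compose α gs)) ∎
  where
  open ≡-Reasoning
  ts = tuples k (allFuns n)
  δ : Vec (BoolFun n) k → BoolFun n → ℕ
  δ gs f = ⟦ does (compose α gs ≗? f) ⟧
  regroup : ∀ a b c → a * b * c ≡ b * (a * c)
  regroup = solve-∀

-- The weight of the event that α is 1, when each argument is the value e x of
-- an independent draw x with weight m x, depends only on the total weights of
-- the draws with value 1 and of those with value 0.
∑-tuples-amp : ∀ {k} (α : BoolFun k) (xs : List A) (m : A → ℕ) (e : A → Bool) →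
  ∑ (tuples k xs) (λ gs → weightProduct m gs * ⟦ α (Vec.map e gs) ⟧)
  ≡ amp α (∑ xs (λ x → m x * ⟦ e x ⟧)) (∑ xs (λ x → m x * ⟦ not (e x) ⟧))
∑-tuples-amp {k = zero}  α xs m e = trans (+-identityʳ _) (+-identityʳ _)
∑-tuples-amp {k = suc k} α xs m e = begin
  ∑ (tuples (suc k) xs) (λ gs → weightProduct m gs * ⟦ α (Vec.map e gs) ⟧)
    ≡⟨ ∑-cartesian _∷_ xs (tuples k xs) _ ⟩
  ∑ xs (λ x → ∑ (tuples k xs) (λ gs → m x * weightProduct m gs * ⟦ α (e x ∷ Vec.map e gs) ⟧))
    ≡⟨ ∑-cong xs (λ x → begin
         ∑ (tuples k xs) (λ gs → m x * weightProduct m gs * ⟦ α (e x ∷ Vec.map e gs) ⟧)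
           ≡⟨ ∑-cong (tuples k xs) (λ gs → *-assoc (m x) (weightProduct m gs) _) ⟩
         ∑ (tuples k xs) (λ gs → m x * (weightProduct m gs * ⟦ α (e x ∷ Vec.map e gs) ⟧))
           ≡⟨ ∑-distribˡ-* (tuples k xs) (m x) _ ⟩
         m x * ∑ (tuples k xs) (λ gs → weightProduct m gs * ⟦ α (e x ∷ Vec.map e gs) ⟧)
           ≡⟨ cong (m x *_) (∑-tuples-amp (α ∘ (e x ∷_)) xs m e) ⟩
         m x * amp (α ∘ (e x ∷_)) s r
           ≡⟨ split (m x) (e x) ⟩
         m x * ⟦ e x ⟧ * a₁ + m x * ⟦ not (e x) ⟧ * a₀ ∎) ⟩
  ∑ xs (λ x → m x * ⟦ e x ⟧ * a₁ + m x * ⟦ not (e x) ⟧ * a₀)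
    ≡⟨ ∑-distrib-+ xs _ _ ⟩
  ∑ xs (λ x → m x * ⟦ e x ⟧ * a₁) + ∑ xs (λ x → m x * ⟦ not (e x) ⟧ * a₀)
    ≡⟨ cong₂ _+_ (∑-distribʳ-* xs a₁ _) (∑-distribʳ-* xs a₀ _) ⟩
  s * a₁ + r * a₀ ∎
  where
  open ≡-Reasoning
  s = ∑ xs (λ x → m x * ⟦ e x ⟧)
  r = ∑ xs (λ x → m x * ⟦ not (e x) ⟧)
  a₁ = amp (α ∘ (true ∷_)) s r
  a₀ = amp (α ∘ (false ∷_)) s r
  split : ∀ c b → c * amp (α ∘ (b ∷_)) s r ≡ c * ⟦ b ⟧ * a₁ + c * ⟦ not b ⟧ * a₀
  split c true  = e₁ c a₁ a₀
    where
    e₁ : ∀ c p q → c * p ≡ c * 1 * p + c * 0 * q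
    e₁ = solve-∀
  split c false = e₀ c a₁ a₀
    where
    e₀ : ∀ c p q → c * q ≡ c * 0 * p + c * 1 * q
    e₀ = solve-∀

-- The weights of the functions with value 1, and with value 0, at x.
hits misses : ∀ {n} → (BoolFun n → ℕ) → Vec Bool n → ℕ
hits   m x = E m (λ f → ⟦ f x ⟧)
misses m x = E m (λ f → ⟦ not (f x) ⟧)

hits-grow : ∀ {k n} (α : BoolFun k) (m : BoolFun n → ℕ) x →
            hits (growWeights α m) x ≡ amp α (hits m x) (misses m x)
hits-grow {n = n} α m x =
  trans (E-growWeights α m (λ e → cong ⟦_⟧ (e x)))
        (∑-tuples-amp α (allFuns n) m (λ f → f x))

misses-grow : ∀ {k n} (α : BoolFun k) (m : BoolFun n → ℕ) x →
              misses (growWeights α m) x ≡ amp (∁ α) (hits m x) (misses m x)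
misses-grow {n = n} α m x =
  trans (E-growWeights α m (λ e → cong (⟦_⟧ ∘ not) (e x)))
        (∑-tuples-amp (∁ α) (allFuns n) m (λ f → f x))

------------------------------------------------------------------------
-- The initial distribution

does-≗?-resp : ∀ {h : BoolFun n} → Respects≗ (λ f → does (h ≗? f))
does-≗?-resp {h = h} {f} {g} e with h ≗? f
... | yes h≗f = sym (dec-true (h ≗? g) (λ x → trans (h≗f x) (e x)))
... | no  h≄f = sym (dec-false (h ≗? g) (λ h≗g → h≄f λ x → trans (h≗g x) (sym (e x))))

growWeights-resp : ∀ {k n} (α : BoolFun k) (m : BoolFun n → ℕ) → Respects≗ (growWeights α m)
growWeights-resp {k} {n} α m e =
  ∑-cong (tuples k (allFuns n))
    (λ gs → cong (λ b → ⟦ b ⟧ * weightProduct m gs) (does-≗?-resp {h = compose α gs} e))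

multiplicity-∉ : ∀ {f : BoolFun n} {S} → f ∉ S → ∑ S (λ g → ⟦ does (g ≗? f) ⟧) ≡ 0
multiplicity-∉ {S = []} f∉S = refl
multiplicity-∉ {f = f} {S = g ∷ S} f∉S
  rewrite dec-false (g ≗? f) (λ e → f∉S (here (sym ∘ e))) = multiplicity-∉ (f∉S ∘ there)

multiplicity-∈ : ∀ {f : BoolFun n} {S} → AllPairs (λ f g → ¬ (f ≗ g)) S → f ∈ S →
                 ∑ S (λ g → ⟦ does (g ≗? f) ⟧) ≡ 1
multiplicity-∈ {f = f} {S = g ∷ S} (g∉S ∷ _) (here f≗g)
  rewrite dec-true (g ≗? f) (sym ∘ f≗g)
  = cong suc (multiplicity-∉ λ f∈S →
      All.lookupWith (λ g≄h f≗h → g≄h λ x → trans (sym (f≗g x)) (f≗h x)) g∉S f∈S)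
multiplicity-∈ {f = f} {S = g ∷ S} (g∉S ∷ ps) (there f∈S)
  rewrite dec-false (g ≗? f) (λ g≗f →
      All.lookupWith (λ g≄h f≗h → g≄h λ x → trans (g≗f x) (f≗h x)) g∉S f∈S)
  = multiplicity-∈ ps f∈S

-- The uniform distribution on S, scaled by the length of S.
membershipWeight : List (BoolFun n) → BoolFun n → ℕ
membershipWeight S f = ⟦ does (f ∈? S) ⟧

membershipWeight≡ : ∀ {S : List (BoolFun n)} → AllPairs (λ f g → ¬ (f ≗ g)) S → ∀ f →
                    membershipWeight S f ≡ ∑ S (λ g → ⟦ does (g ≗? f) ⟧)
membershipWeight≡ {S = S} distinct f with f ∈? S
... | yes f∈S = sym (multiplicity-∈ distinct f∈S)
... | no  f∉S = sym (multiplicity-∉ f∉S)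

membershipWeight-resp : ∀ (S : List (BoolFun n)) → Respects≗ (membershipWeight S)
membershipWeight-resp S {f} {g} e with f ∈? S
... | yes f∈S = sym (cong ⟦_⟧ (dec-true (g ∈? S) (Any.map (λ p x → trans (sym (e x)) (p x)) f∈S)))
... | no  f∉S = sym (cong ⟦_⟧ (dec-false (g ∈? S) (f∉S ∘ Any.map (λ p x → trans (e x) (p x)))))

E-membershipWeight : ∀ {S : List (BoolFun n)} → AllPairs (λ f g → ¬ (f ≗ g)) S →
                     ∀ {φ} → Respects≗ φ → E (membershipWeight S) φ ≡ ∑ S φ
E-membershipWeight {n} {S} distinct {φ} resp = begin
  ∑ (allFuns n) (λ f → membershipWeight S f * φ f)
    ≡⟨ ∑-cong (allFuns n) (λ f → cong (_* φ f) (membershipWeight≡ distinct f)) ⟩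
  ∑ (allFuns n) (λ f → ∑ S (λ g → ⟦ does (g ≗? f) ⟧) * φ f)
    ≡⟨ ∑-cong (allFuns n) (λ f → sym (∑-distribʳ-* S (φ f) _)) ⟩
  ∑ (allFuns n) (λ f → ∑ S (λ g → ⟦ does (g ≗? f) ⟧ * φ f))
    ≡⟨ ∑-swap (allFuns n) S _ ⟩
  ∑ S (λ g → ∑ (allFuns n) (λ f → ⟦ does (g ≗? f) ⟧ * φ f))
    ≡⟨ ∑-cong S (λ g → ∑-allFuns-select g resp) ⟩
  ∑ S φ ∎
  where open ≡-Reasoning

weight≡∑ : ∀ (x : Vec Bool n) → weight x ≡ ∑ (allFin n) (λ i → ⟦ lookup x i ⟧)
weight≡∑ []          = refl
weight≡∑ (true ∷ x)  = trans (cong suc (weight≡∑ x)) (sym (∑-allFin-suc (λ i → ⟦ lookup (true ∷ x) i ⟧)))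
weight≡∑ (false ∷ x) = trans (weight≡∑ x) (sym (∑-allFin-suc (λ i → ⟦ lookup (false ∷ x) i ⟧)))

lookup-zeros : ∀ (i : Fin n) → lookup (zeros n) i ≡ false
lookup-zeros zero    = refl
lookup-zeros (suc i) = lookup-zeros i

lookup-ones : ∀ (i : Fin n) → lookup (ones n) i ≡ true
lookup-ones zero    = refl
lookup-ones (suc i) = lookup-ones i

lookup-unit : ∀ (i : Fin n) → lookup (unit i) i ≡ true
lookup-unit zero    = refl
lookup-unit (suc i) = lookup-unit i

projection-injective : ∀ {i j : Fin n} → projection i ≗ projection j → i ≡ j
projection-injective {i = i} {j} e = lookup-unit⁻¹ i j (trans (sym (e (unit i))) (lookup-unit i))
  where
  lookup-unit⁻¹ : ∀ {n} (i j : Fin n) → lookup (unit i) j ≡ true → i ≡ j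
  lookup-unit⁻¹ zero    zero    _ = refl
  lookup-unit⁻¹ zero    (suc j) e = contradiction (trans (sym e) (lookup-zeros j)) λ ()
  lookup-unit⁻¹ (suc i) (suc j) e = cong suc (lookup-unit⁻¹ i j e)

projection≄const : ∀ (i : Fin n) b → ¬ (projection i ≗ const b)
projection≄const i true  e = contradiction (trans (sym (e (zeros _))) (lookup-zeros i)) λ ()
projection≄const i false e = contradiction (trans (sym (e (ones _))) (lookup-ones i)) λ ()

-- A sum over Fin n with a single nonzero term.
∑-allFin-single : ∀ (j : Fin n) {f : Fin n → ℕ} → (∀ i → j ≢ i → f i ≡ 0) →
                  ∑ (allFin n) f ≡ f j
∑-allFin-single {suc n} zero {f} h =
  trans (∑-allFin-suc f)
  (trans (cong (f zero +_) (trans (∑-cong (allFin n) (λ i → h (suc i) λ ())) (∑-zero (allFin n))))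
         (+-identityʳ _))
∑-allFin-single (suc j) {f} h =
  trans (∑-allFin-suc f)
        (cong₂ _+_ (h zero λ ()) (∑-allFin-single j (λ i j≢i → h (suc i) (j≢i ∘ Fin.suc-injective))))

-- The value at x of the projections equal to g. The projections are distinct,
-- so at most one of them contributes.
projectionTerms : BoolFun n → Vec Bool n → ℕ
projectionTerms g x = ∑ (allFin _) (λ i → ⟦ lookup x i ⟧ * ⟦ does (g ≗? projection i) ⟧)

-- The values of projections and constants, in a form whose sum over the support
-- involves only the multiplicities of the projections and of the constant 1.
initial-value : ∀ (g : BoolFun n) → (∃[ i ] g ≗ projection i) ⊎ (∃[ b ] g ≗ const b) → ∀ x →
                ⟦ g x ⟧ ≡ projectionTerms g x + ⟦ does (g ≗? const true) ⟧
initial-value g (inj₁ (j , e)) x = begin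
  ⟦ g x ⟧                                                 ≡⟨ cong ⟦_⟧ (e x) ⟩
  ⟦ lookup x j ⟧                                          ≡⟨ *-identityʳ _ ⟨
  ⟦ lookup x j ⟧ * 1                                      ≡⟨ cong (λ b → ⟦ lookup x j ⟧ * ⟦ b ⟧) (dec-true (g ≗? projection j) e) ⟨
  ⟦ lookup x j ⟧ * ⟦ does (g ≗? projection j) ⟧           ≡⟨ ∑-allFin-single j other ⟨
  projectionTerms g x                                     ≡⟨ +-identityʳ _ ⟨
  projectionTerms g x + 0                                 ≡⟨ cong (λ b → projectionTerms g x + ⟦ b ⟧) (dec-false (g ≗? const true) not-const) ⟨
  projectionTerms g x + ⟦ does (g ≗? const true) ⟧        ∎
  where
  open ≡-Reasoning
  not-const : ¬ (g ≗ const true)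
  not-const g≗ = projection≄const j true (λ y → trans (sym (e y)) (g≗ y))
  other : ∀ i → j ≢ i → ⟦ lookup x i ⟧ * ⟦ does (g ≗? projection i) ⟧ ≡ 0
  other i j≢i rewrite dec-false (g ≗? projection i)
                        (λ g≗ → j≢i (projection-injective (λ y → trans (sym (e y)) (g≗ y))))
    = *-zeroʳ ⟦ lookup x i ⟧
initial-value {n} g (inj₂ (b , e)) x = begin
  ⟦ g x ⟧                                                 ≡⟨ cong ⟦_⟧ (value b e) ⟩
  ⟦ does (g ≗? const true) ⟧                              ≡⟨ cong (_+ ⟦ does (g ≗? const true) ⟧) none ⟨
  projectionTerms g x + ⟦ does (g ≗? const true) ⟧        ∎
  where
  open ≡-Reasoning
  value : ∀ b → g ≗ const b → g x ≡ does (g ≗? const true)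
  value true  e = trans (e x) (sym (dec-true (g ≗? const true) e))
  value false e = trans (e x) (sym (dec-false (g ≗? const true)
                    (λ g≗ → contradiction (trans (sym (g≗ x)) (e x)) λ ())))
  none : projectionTerms g x ≡ 0
  none = trans (∑-cong (allFin n) (λ i → trans
           (cong (λ c → ⟦ lookup x i ⟧ * ⟦ c ⟧) (dec-false (g ≗? projection i)
             (λ g≗ → projection≄const i b (λ y → trans (sym (g≗ y)) (e y)))))
           (*-zeroʳ ⟦ lookup x i ⟧)))
         (∑-zero (allFin n))

module Initial {S : List (BoolFun n)} (support : IsInitialSupport S) (noNeg : NoNegations S) where
  open IsInitialSupport support

  projectionOrConstant : All (λ g → (∃[ i ] g ≗ projection i) ⊎ (∃[ b ] g ≗ const b)) S
  projectionOrConstant = All.tabulate classify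
    where
    classify : ∀ {g} → g Membership.∈ S → (∃[ i ] g ≗ projection i) ⊎ (∃[ b ] g ≗ const b)
    classify g∈S with All.lookup onlyLiteralsOrConstants g∈S
    ... | inj₁ p              = inj₁ p
    ... | inj₂ (inj₁ (i , e)) =
      contradiction (Any.map (λ { refl → sym ∘ e }) g∈S) (noNeg i)
    ... | inj₂ (inj₂ c)       = inj₂ c

  -- Each projection occurs exactly once, so the number of entries of S with value
  -- 1 at x is the weight of x, plus one if the constant 1 belongs to S.
  ∑S≡weight : ∀ x → ∑ S (λ g → ⟦ g x ⟧) ≡ weight x + ∑ S (λ g → ⟦ does (g ≗? const true) ⟧)
  ∑S≡weight x = begin
    ∑ S (λ g → ⟦ g x ⟧)
      ≡⟨ ∑-cong-All (All.map (λ {g} p → initial-value g p x) projectionOrConstant) ⟩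
    ∑ S (λ g → projectionTerms g x + ⟦ does (g ≗? const true) ⟧)
      ≡⟨ ∑-distrib-+ S _ _ ⟩
    ∑ S (λ g → projectionTerms g x) + c
      ≡⟨ cong (_+ c) (∑-swap S (allFin n) _) ⟩
    ∑ (allFin n) (λ i → ∑ S (λ g → ⟦ lookup x i ⟧ * ⟦ does (g ≗? projection i) ⟧)) + c
      ≡⟨ cong (_+ c) (∑-cong (allFin n) (λ i → begin
           ∑ S (λ g → ⟦ lookup x i ⟧ * ⟦ does (g ≗? projection i) ⟧)
             ≡⟨ ∑-distribˡ-* S ⟦ lookup x i ⟧ _ ⟩
           ⟦ lookup x i ⟧ * ∑ S (λ g → ⟦ does (g ≗? projection i) ⟧)
             ≡⟨ cong (⟦ lookup x i ⟧ *_) (multiplicity-∈ distinct (containsProjections i)) ⟩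
           ⟦ lookup x i ⟧ * 1
             ≡⟨ *-identityʳ _ ⟩
           ⟦ lookup x i ⟧ ∎)) ⟩
    ∑ (allFin n) (λ i → ⟦ lookup x i ⟧) + c
      ≡⟨ cong (_+ c) (weight≡∑ x) ⟨
    weight x + c ∎
    where
    open ≡-Reasoning
    c = ∑ S (λ g → ⟦ does (g ≗? const true) ⟧)

  hits-initial : ∀ x → hits (membershipWeight S) x
                       ≡ weight x + ∑ S (λ g → ⟦ does (g ≗? const true) ⟧)
  hits-initial x = trans (E-membershipWeight distinct (λ e → cong ⟦_⟧ (e x))) (∑S≡weight x)

  hits+misses-initial : ∀ x → hits (membershipWeight S) x + misses (membershipWeight S) x ≡ length S
  hits+misses-initial x = begin
    hits (membershipWeight S) x + misses (membershipWeight S) x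
      ≡⟨ cong₂ _+_ (E-membershipWeight distinct (λ e → cong ⟦_⟧ (e x)))
                   (E-membershipWeight distinct (λ e → cong (⟦_⟧ ∘ not) (e x))) ⟩
    ∑ S (λ g → ⟦ g x ⟧) + ∑ S (λ g → ⟦ not (g x) ⟧)
      ≡⟨ ∑-distrib-+ S _ _ ⟨
    ∑ S (λ g → ⟦ g x ⟧ + ⟦ not (g x) ⟧)
      ≡⟨ ∑-cong S (λ g → ⟦⟧+⟦not⟧ (g x)) ⟩
    ∑ S (const 1)
      ≡⟨ ∑-one S ⟩
    length S ∎
    where open ≡-Reasoning

------------------------------------------------------------------------
-- Balanced functions

length-filter : ∀ (b : A → Bool) xs →
                length (List.filter (λ x → b x Bool.≟ true) xs) ≡ ∑ xs (λ x → ⟦ b x ⟧)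
length-filter b [] = refl
length-filter b (x ∷ xs) with b x
... | true  = cong suc (length-filter b xs)
... | false = length-filter b xs

∑-inputs : ∀ {k} (α : BoolFun k) → ∑ (inputs k) (λ x → ⟦ α x ⟧) ≡ amp α 1 1
∑-inputs {zero}  α = +-identityʳ _
∑-inputs {suc k} α = begin
  ∑ (inputs (suc k)) (λ x → ⟦ α x ⟧)
    ≡⟨ ∑-cartesian _∷_ (false ∷ true ∷ []) (inputs k) _ ⟩
  ∑ (inputs k) (λ x → ⟦ α (false ∷ x) ⟧) + (∑ (inputs k) (λ x → ⟦ α (true ∷ x) ⟧) + 0)
    ≡⟨ cong₂ (λ a b → a + (b + 0)) (∑-inputs (α ∘ (false ∷_))) (∑-inputs (α ∘ (true ∷_))) ⟩
  amp (α ∘ (false ∷_)) 1 1 + (amp (α ∘ (true ∷_)) 1 1 + 0)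
    ≡⟨ regroup (amp (α ∘ (false ∷_)) 1 1) _ ⟩
  amp α 1 1 ∎
  where
  open ≡-Reasoning
  regroup : ∀ a b → a + (b + 0) ≡ 1 * b + 1 * a
  regroup = solve-∀

fair⇒balanced : ∀ {k} (α : BoolFun k) → Fair α → Balanced α
fair⇒balanced {k} α fair = begin
  2 * length (List.filter (λ x → α x Bool.≟ true) (inputs k))
    ≡⟨ cong (2 *_) (trans (length-filter α (inputs k)) (∑-inputs α)) ⟩
  amp α 1 1 + (amp α 1 1 + 0)
    ≡⟨ cong (amp α 1 1 +_) (trans (+-identityʳ _) fair) ⟩
  amp α 1 1 + amp (∁ α) 1 1
    ≡⟨ amp-total α 1 1 ⟩
  2 ^ k ∎
  where open ≡-Reasoning

------------------------------------------------------------------------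
-- Natural numbers as rationals

-- With denominator 1 by definition, hence free of normalisation.
fromℕ : ℕ → ℚ
fromℕ n = fromℤ (ℤ.+ n)

fromℕ-+ : ∀ m n → fromℕ (m + n) ≡ fromℕ m ℚ.+ fromℕ n
fromℕ-+ m n = ℚ.toℚᵘ-injective (ℚᵘ.≃-trans
  (ℚᵘ.*≡* (cong (ℤ._* ℤ.+ 1) (sym (cong₂ ℤ._+_ (ℤ.*-identityʳ (ℤ.+ m)) (ℤ.*-identityʳ (ℤ.+ n))))))
  (ℚᵘ.≃-sym (ℚ.toℚᵘ-homo-+ (fromℕ m) (fromℕ n))))

fromℕ-* : ∀ m n → fromℕ (m * n) ≡ fromℕ m ℚ.* fromℕ n
fromℕ-* m n = ℚ.toℚᵘ-injective (ℚᵘ.≃-trans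
  (ℚᵘ.*≡* (cong (ℤ._* ℤ.+ 1) (ℤ.pos-* m n)))
  (ℚᵘ.≃-sym (ℚ.toℚᵘ-homo-* (fromℕ m) (fromℕ n))))

fromℕ-mono-< : ∀ {m n} → m < n → fromℕ m ℚ.< fromℕ n
fromℕ-mono-< m<n = ℚ.*<* (ℤ.*-monoʳ-<-pos (ℤ.+ 1) (+<+ m<n))

/-inverse : ∀ d .{{_ : NonZero d}} → (ℤ.+ 1 ℚ./ d) ℚ.* fromℕ d ≡ 1ℚ
/-inverse (suc d) = ℚ.toℚᵘ-injective (ℚᵘ.≃-trans
  (ℚ.toℚᵘ-homo-* (ℤ.+ 1 ℚ./ suc d) (fromℕ (suc d)))
  (ℚᵘ.≃-trans (ℚᵘ.*-congʳ (ℚ.toℚᵘ-fromℚᵘ (mkℚᵘ (ℤ.+ 1) d)))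
    (ℚᵘ.*≡* (cong ℤ.+_ (e d)))))
  where
  e : ∀ d → (1 + d + 0) * 1 ≡ 1 * ((1 + d) * 1)
  e = solve-∀

archimedean : ∀ {ε} → 0ℚ ℚ.< ε → ∃[ b ] 1ℚ ℚ.≤ ε ℚ.* fromℕ b
archimedean {ε@(mkℚ (ℤ.+ suc a) d _)} ε>0 = suc d , ℚ.toℚᵘ-cancel-≤ (ℚᵘ.≤-trans
  (ℚᵘ.*≤* (+≤+ (≤-trans (m≤m+n _ (a * suc d)) (≤-reflexive (e a d)))))
  (ℚᵘ.≤-reflexive (ℚᵘ.≃-sym (ℚ.toℚᵘ-homo-* ε (fromℕ (suc d))))))
  where
  e : ∀ a d → 1 * ((1 + d) * 1) + a * (1 + d) ≡ (1 + a) * (1 + d) * 1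
  e = solve-∀
archimedean {mkℚ (ℤ.+ 0) d _}            (ℚ.*<* (+<+ ()))
archimedean {mkℚ ℤ.-[1+ a ] d _} (ℚ.*<* ())

------------------------------------------------------------------------
-- The growth process scaled to natural numbers

sum-scaled : ∀ (xs : List A) {F : A → ℚ} {G : A → ℕ} c →
             (∀ x → F x ℚ.* c ≡ fromℕ (G x)) → sum (List.map F xs) ℚ.* c ≡ fromℕ (∑ xs G)
sum-scaled []       c h = ℚ.*-zeroˡ c
sum-scaled (x ∷ xs) {F} {G} c h =
  trans (ℚ.*-distribʳ-+ c (F x) (sum (List.map F xs)))
  (trans (cong₂ ℚ._+_ (h x) (sum-scaled xs c h)) (sym (fromℕ-+ (G x) (∑ xs G))))

-- The masses π are the weights m over the common denominator D.
Scaled : Mass n → (BoolFun n → ℕ) → ℕ → Set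
Scaled π m D = ∀ f → π f ℚ.* fromℕ D ≡ fromℕ (m f)

productMass-scaled : ∀ {π : Mass n} {m D} → Scaled π m D → ∀ {k} (gs : Vec (BoolFun n) k) →
                     productMass π gs ℚ.* fromℕ (D ^ k) ≡ fromℕ (weightProduct m gs)
productMass-scaled h [] = ℚ.*-identityˡ 1ℚ
productMass-scaled {π = π} {m} {D} h {suc k} (g ∷ gs) = begin
  π g ℚ.* productMass π gs ℚ.* fromℕ (D * D ^ k)
    ≡⟨ cong (π g ℚ.* productMass π gs ℚ.*_) (fromℕ-* D (D ^ k)) ⟩
  π g ℚ.* productMass π gs ℚ.* (fromℕ D ℚ.* fromℕ (D ^ k))
    ≡⟨ regroup (π g) (productMass π gs) (fromℕ D) (fromℕ (D ^ k)) ⟩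
  π g ℚ.* fromℕ D ℚ.* (productMass π gs ℚ.* fromℕ (D ^ k))
    ≡⟨ cong₂ ℚ._*_ (h g) (productMass-scaled {m = m} h gs) ⟩
  fromℕ (m g) ℚ.* fromℕ (weightProduct m gs)
    ≡⟨ fromℕ-* (m g) (weightProduct m gs) ⟨
  fromℕ (m g * weightProduct m gs) ∎
  where
  open ≡-Reasoning
  regroup : ∀ a b c d → a ℚ.* b ℚ.* (c ℚ.* d) ≡ a ℚ.* c ℚ.* (b ℚ.* d)
  regroup = solve 4 (λ a b c d → a :* b :* (c :* d) := a :* c :* (b :* d)) refl

grow-scaled : ∀ (α : BoolFun k) {π : Mass n} {m D} → Scaled π m D →
              Scaled (grow α π) (growWeights α m) (D ^ k)
grow-scaled {k} {n} α {π} {m} {D} h f =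
  sum-scaled (tuples k (allFuns n)) (fromℕ (D ^ k)) λ gs → term gs (does (compose α gs ≗? f))
  where
  term : ∀ gs b → (if b then productMass π gs else 0ℚ) ℚ.* fromℕ (D ^ k)
                  ≡ fromℕ (⟦ b ⟧ * weightProduct m gs)
  term gs true  = trans (productMass-scaled {m = m} h gs)
                        (cong fromℕ (sym (+-identityʳ (weightProduct m gs))))
  term gs false = ℚ.*-zeroˡ (fromℕ (D ^ k))

uniform-scaled : ∀ (S : List (BoolFun n)) .{{_ : NonZero (length S)}} →
                 Scaled (uniform S) (membershipWeight S) (length S)
uniform-scaled S f with does (f ∈? S)
... | true  = /-inverse (length S)
... | false = ℚ.*-zeroˡ (fromℕ (length S))

-- The numerators of the masses after i growth steps.
weights : BoolFun k → List (BoolFun n) → ℕ → BoolFun n → ℕ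
weights α S zero    = membershipWeight S
weights α S (suc i) = growWeights α (weights α S i)

-- Their common denominator. A step multiplies k masses.
denominator : BoolFun k → List (BoolFun n) → ℕ → ℕ
denominator         α S zero    = length S
denominator {k = k} α S (suc i) = denominator α S i ^ k

growth-scaled : ∀ (α : BoolFun k) (S : List (BoolFun n)) .{{_ : NonZero (length S)}} i →
                Scaled (growth (uniform S) α i) (weights α S i) (denominator α S i)
growth-scaled α S zero    = uniform-scaled S
growth-scaled α S (suc i) = grow-scaled α {m = weights α S i} (growth-scaled α S i)

weights-resp : ∀ (α : BoolFun k) (S : List (BoolFun n)) i → Respects≗ (weights α S i)
weights-resp α S zero    = membershipWeight-resp S
weights-resp α S (suc i) = growWeights-resp α (weights α S i)

denominator>0 : ∀ (α : BoolFun k) (S : List (BoolFun n)) .{{_ : NonZero (length S)}} i →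
                0 < denominator α S i
denominator>0 α S zero = >-nonZero⁻¹ (length S)
denominator>0 {k = k} α S (suc i) = ^-pos k (denominator>0 α S i)

------------------------------------------------------------------------
-- From the inputs to the distributions

∑-bound : ∀ (xs : List A) (w : A → ℕ → ℕ) (D : ℕ → ℕ) →
          (∀ x → ∃[ C ] (∀ i → w x i * i ≤ C * D i)) →
          ∃[ C ] (∀ i → ∑ xs (λ x → w x i) * i ≤ C * D i)
∑-bound []       w D h = 0 , λ i → z≤n
∑-bound (x ∷ xs) w D h with C , p ← h x | C′ , q ← ∑-bound xs w D h =
  C + C′ , λ i → begin
    (w x i + ∑ xs (λ x → w x i)) * i        ≡⟨ *-distribʳ-+ i (w x i) _ ⟩
    w x i * i + ∑ xs (λ x → w x i) * i      ≤⟨ +-mono-≤ (p i) (q i) ⟩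
    C * D i + C′ * D i                      ≡⟨ *-distribʳ-+ (D i) C C′ ⟨
    (C + C′) * D i                          ∎
  where open ≤-Reasoning

-- A sequence whose absolute values e i / D i are at most C/i tends to 0.
vanishing-ratio : ∀ {x : ℕ → ℚ} {D e : ℕ → ℕ} C → (∀ i → 0 < D i) →
  (∀ i → ∣ x i ∣ ℚ.* fromℕ (D i) ≡ fromℕ (e i)) → (∀ i → e i * i ≤ C * D i) →
  ∀ ε → 0ℚ ℚ.< ε → ∃[ N ] (∀ i → N ≤ i → ∣ x i ∣ ℚ.< ε)
vanishing-ratio {x} {D} {e} C D>0 scaled bound ε ε>0 with b , 1≤εb ← archimedean ε>0 =
  suc (C * b) , λ i N≤i → ℚ.*-cancelʳ-<-nonNeg (fromℕ (D i)) (begin-strict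
    ∣ x i ∣ ℚ.* fromℕ (D i)                    ≡⟨ scaled i ⟩
    fromℕ (e i)                                ≡⟨ ℚ.*-identityˡ (fromℕ (e i)) ⟨
    1ℚ ℚ.* fromℕ (e i)                         ≤⟨ ℚ.*-monoʳ-≤-nonNeg (fromℕ (e i)) 1≤εb ⟩
    ε ℚ.* fromℕ b ℚ.* fromℕ (e i)              ≡⟨ ℚ.*-assoc ε (fromℕ b) (fromℕ (e i)) ⟩
    ε ℚ.* (fromℕ b ℚ.* fromℕ (e i))            ≡⟨ cong (ε ℚ.*_) (fromℕ-* b (e i)) ⟨
    ε ℚ.* fromℕ (b * e i)                      <⟨ ℚ.*-monoʳ-<-pos ε {{ℚ.positive ε>0}} (fromℕ-mono-< (small i b N≤i)) ⟩
    ε ℚ.* fromℕ (D i)                          ∎)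
  where
  open ℚ.≤-Reasoning
  -- For i > C * b, an i-th value of at least 1/b would violate the bound C/i.
  small : ∀ i b → suc (C * b) ≤ i → b * e i < D i
  small i b N≤i = ≰⇒> λ D≤be → <⇒≱ (exceeds D≤be) (bound i)
    where
    exceeds : D i ≤ b * e i → C * D i < e i * i
    exceeds D≤be = <-≤-trans (<-≤-trans (m<n+m (C * D i) e>0) (+-monoʳ-≤ (e i) (*-monoʳ-≤ C D≤be)))
                  (≤-trans (≤-reflexive (regroup (e i) C b)) (*-monoʳ-≤ (e i) N≤i))
      where
      regroup : ∀ e C b → e + C * (b * e) ≡ e * (1 + C * b)
      regroup = solve-∀
      e>0 : 0 < e i
      e>0 = n≢0⇒n>0 λ e≡0 → <⇒≱ (D>0 i)
        (≤-trans D≤be (≤-reflexive (trans (cong (b *_) e≡0) (*-zeroʳ b))))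

E-mono : ∀ (m : BoolFun n → ℕ) {φ ψ : BoolFun n → ℕ} → (∀ f → φ f ≤ ψ f) → E m φ ≤ E m ψ
E-mono {n} m h = ∑-mono (allFuns n) (λ f → *-monoʳ-≤ (m f) (h f))

E-∑ : ∀ (m : BoolFun n → ℕ) (xs : List A) (φ : A → BoolFun n → ℕ) →
      E m (λ f → ∑ xs (λ x → φ x f)) ≡ ∑ xs (λ x → E m (φ x))
E-∑ {n} m xs φ =
  trans (∑-cong (allFuns n) (λ f → sym (∑-distribˡ-* xs (m f) (λ x → φ x f))))
        (∑-swap (allFuns n) xs _)

E-δ : ∀ {m : BoolFun n → ℕ} → Respects≗ m → ∀ g → E m (λ f → ⟦ does (g ≗? f) ⟧) ≡ m g
E-δ {n} {m} resp g =
  trans (∑-cong (allFuns n) (λ f → *-comm (m f) ⟦ does (g ≗? f) ⟧)) (∑-allFuns-select g resp)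

E-+ : ∀ (m : BoolFun n → ℕ) (φ ψ : BoolFun n → ℕ) → E m φ + E m ψ ≡ E m (λ f → φ f + ψ f)
E-+ {n} m φ ψ =
  trans (sym (∑-distrib-+ (allFuns n) _ _))
        (∑-cong (allFuns n) (λ f → sym (*-distribˡ-+ (m f) (φ f) (ψ f))))

E-complement : ∀ (m : BoolFun n → ℕ) (b c : BoolFun n → Bool) →
  E m (λ f → ⟦ b f ⟧) + E m (λ f → ⟦ not (b f) ⟧) ≡ E m (λ f → ⟦ c f ⟧) + E m (λ f → ⟦ not (c f) ⟧)
E-complement {n} m b c = trans (one b) (sym (one c))
  where
  one : ∀ b → E m (λ f → ⟦ b f ⟧) + E m (λ f → ⟦ not (b f) ⟧) ≡ E m (const 1)
  one b = trans (E-+ m _ _) (∑-cong (allFuns n) (λ f → cong (m f *_) (⟦⟧+⟦not⟧ (b f))))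

-- The distribution concentrated on h.
pointMass : BoolFun n → Mass n
pointMass h f = if does (h ≗? f) then 1ℚ else 0ℚ

-- The weight of the functions other than h.
off : (BoolFun n → ℕ) → BoolFun n → ℕ
off m h = E m (λ f → ⟦ not (does (h ≗? f)) ⟧)

module _ (α : BoolFun k) (S : List (BoolFun n)) .{{_ : NonZero (length S)}}
         (mon : Monotone α) (unbalanced : Unbalanced α)
         (support : IsInitialSupport S) (noNeg : NoNegations S) where
  open Initial support noNeg

  private
    m : ℕ → BoolFun n → ℕ
    m = weights α S
    D : ℕ → ℕ
    D = denominator α S
    c : ℕ
    c = ∑ S (λ g → ⟦ does (g ≗? const true) ⟧)

  hits+misses : ∀ x i → hits (m i) x + misses (m i) x ≡ D i
  hits+misses x zero    = hits+misses-initial x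
  hits+misses x (suc i) =
    trans (cong₂ _+_ (hits-grow α (m i) x) (misses-grow α (m i) x))
    (trans (amp-total α (hits (m i) x) (misses (m i) x)) (cong (_^ k) (hits+misses x i)))

  -- The prediction that the iterates tend to 1 at the inputs of weight w, where
  -- initially w + c entries of S have the value 1.
  RisesAt : ℕ → Set
  RisesAt w = Rises α (w + c) (length S ∸ (w + c))

  risesAt? : ∀ w → Dec (RisesAt w)
  risesAt? w = rises? α (w + c) (length S ∸ (w + c))

  risesAt-upward : ∀ {w} → RisesAt w → RisesAt (suc w)
  risesAt-upward {w} =
    Rises-monotone mon (n≤1+n (w + c)) (∸-monoʳ-≤ (length S) (n≤1+n (w + c)))

  misses-initial : ∀ x → misses (m 0) x ≡ length S ∸ (weight x + c)
  misses-initial x = begin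
    misses (m 0) x                                   ≡⟨ m+n∸m≡n (hits (m 0) x) _ ⟨
    hits (m 0) x + misses (m 0) x ∸ hits (m 0) x     ≡⟨ cong₂ _∸_ (hits+misses x 0) (hits-initial x) ⟩
    length S ∸ (weight x + c)                        ∎
    where open ≡-Reasoning

  rises≡ : ∀ x → Rises α (hits (m 0) x) (misses (m 0) x) ≡ RisesAt (weight x)
  rises≡ x = cong₂ (Rises α) (hits-initial x) (misses-initial x)

  module AtInput (x : Vec Bool n) =
    Orbit mon (unbalanced ∘ fair⇒balanced α)
          {λ i → hits (m i) x} {λ i → misses (m i) x}
          (λ i → hits-grow α (m i) x) (λ i → misses-grow α (m i) x)

  -- At the input x, the probability of a value other than b is at most C/i, if b
  -- is the limit predicted by RisesAt.
  disagreement-bound : ∀ x b → (b ≡ true → RisesAt (weight x)) → (b ≡ false → ¬ RisesAt (weight x)) →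
    ∃[ C ] (∀ i → E (m i) (λ f → ⟦ b xor f x ⟧) * i ≤ C * D i)
  disagreement-bound x true  h _
    with C , p ← AtInput.rises⇒vanishes x (subst id (sym (rises≡ x)) (h refl)) =
    C , λ i → ≤-trans (p i) (≤-reflexive (cong (C *_)
          (trans (+-comm (misses (m i) x) (hits (m i) x)) (hits+misses x i))))
  disagreement-bound x false _ h
    with C , p ← AtInput.¬rises⇒vanishes x (h refl ∘ subst id (rises≡ x)) =
    C , λ i → ≤-trans (p i) (≤-reflexive (cong (C *_) (hits+misses x i)))

  -- If h takes the predicted limit at every input, all mass concentrates on h.
  concentrates : ∀ {h : BoolFun n} →
    (∀ x → h x ≡ true → RisesAt (weight x)) → (∀ x → h x ≡ false → ¬ RisesAt (weight x)) →
    IsLimitingDistribution (uniform S) α (pointMass h)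
  concentrates {h} above below = limit
    where
    bound : ∃[ C ] (∀ i → off (m i) h * i ≤ C * D i)
    bound with C , p ← ∑-bound (inputs n) (λ x i → E (m i) (λ f → ⟦ h x xor f x ⟧)) D
                         (λ x → disagreement-bound x (h x) (above x) (below x)) =
      C , λ i → ≤-trans (*-monoˡ-≤ i (≤-trans (E-mono (m i) (⟦not-≗?⟧≤ h))
                  (≤-reflexive (E-∑ (m i) (inputs n) _)))) (p i)

    -- The total weight is the sum of hits and misses at any input; that at zeros
    -- serves here.
    mass+off : ∀ i → m i h + off (m i) h ≡ D i
    mass+off i =
      trans (cong (_+ off (m i) h) (sym (E-δ (weights-resp α S i) h)))
      (trans (E-complement (m i) (λ f → does (h ≗? f)) (λ f → f (zeros n)))
             (hits+misses (zeros n) i))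

    mass≤off : ∀ i {f} → ¬ (h ≗ f) → m i f ≤ off (m i) h
    mass≤off i {f} h≄f = ≤-trans (≤-reflexive (sym (E-δ (weights-resp α S i) f)))
      (E-mono (m i) pointwise)
      where
      pointwise : ∀ g → ⟦ does (f ≗? g) ⟧ ≤ ⟦ not (does (h ≗? g)) ⟧
      pointwise g with f ≗? g
      ... | no _    = z≤n
      ... | yes f≗g rewrite dec-false (h ≗? g) (λ h≗g → h≄f λ x → trans (h≗g x) (sym (f≗g x))) =
        ≤-refl

    abs-scaled : ∀ p i → ∣ p ∣ ℚ.* fromℕ (D i) ≡ ∣ p ℚ.* fromℕ (D i) ∣
    abs-scaled p i = sym (ℚ.∣p*q∣≡∣p∣*∣q∣ p (fromℕ (D i)))

    limit : IsLimitingDistribution (uniform S) α (pointMass h)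
    limit f with h ≗? f
    ... | yes h≗f = vanishing-ratio (proj₁ bound) (denominator>0 α S) deficit (proj₂ bound)
      where
      -- The missing mass at the limit function is the mass of all other functions.
      deficit : ∀ i → ∣ growth (uniform S) α i f ℚ.- 1ℚ ∣ ℚ.* fromℕ (D i) ≡ fromℕ (off (m i) h)
      deficit i = begin
        ∣ p ℚ.- 1ℚ ∣ ℚ.* d                   ≡⟨ abs-scaled (p ℚ.- 1ℚ) i ⟩
        ∣ (p ℚ.- 1ℚ) ℚ.* d ∣                 ≡⟨ cong ∣_∣ (expand p d) ⟩
        ∣ p ℚ.* d ℚ.- d ∣                    ≡⟨ cong₂ (λ a b → ∣ a ℚ.- b ∣) (growth-scaled α S i f) D≡ ⟩
        ∣ q ℚ.- (q ℚ.+ o) ∣                  ≡⟨ cong ∣_∣ (cancel q o) ⟩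
        ∣ ℚ.- o ∣                            ≡⟨ ℚ.∣-p∣≡∣p∣ o ⟩
        o                                    ∎
        where
        open ≡-Reasoning
        p = growth (uniform S) α i f
        d = fromℕ (D i)
        q = fromℕ (m i f)
        o = fromℕ (off (m i) h)
        D≡ : d ≡ q ℚ.+ o
        D≡ = trans (cong fromℕ (trans (sym (mass+off i))
                     (cong (_+ off (m i) h) (weights-resp α S i h≗f))))
                   (fromℕ-+ (m i f) (off (m i) h))
        expand : ∀ p d → (p ℚ.- 1ℚ) ℚ.* d ≡ p ℚ.* d ℚ.- d
        expand = solve 2 (λ p d → (p :- con 1ℚ) :* d := p :* d :- d) refl
        cancel : ∀ q o → q ℚ.- (q ℚ.+ o) ≡ ℚ.- o
        cancel = solve 2 (λ q o → q :- (q :+ o) := :- o) refl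
    ... | no h≄f = vanishing-ratio (proj₁ bound) (denominator>0 α S) residue
                     (λ i → ≤-trans (*-monoˡ-≤ i (mass≤off i h≄f)) (proj₂ bound i))
      where
      residue : ∀ i → ∣ growth (uniform S) α i f ℚ.- 0ℚ ∣ ℚ.* fromℕ (D i) ≡ fromℕ (m i f)
      residue i = trans (abs-scaled (growth (uniform S) α i f ℚ.- 0ℚ) i) (cong ∣_∣ (trans
        (cong (ℚ._* fromℕ (D i)) (ℚ.+-identityʳ (growth (uniform S) α i f)))
        (growth-scaled α S i f)))

------------------------------------------------------------------------
-- Threshold functions

-- An upward closed decidable property of the numbers up to n holds exactly from
-- some m on, where m = n + 1 if it holds nowhere.
threshold-cut : ∀ n {P : ℕ → Set} → (∀ w → Dec (P w)) → (∀ {w} → P w → P (suc w)) →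
  ∃[ m ] (m ≤ suc n × (∀ {w} → w ≤ n → m ≤ w → P w) × (∀ {w} → w ≤ n → ¬ m ≤ w → ¬ P w))
threshold-cut n {P} P? up with P? 0
... | yes p = 0 , z≤n , (λ _ _ → all _) , (λ _ ¬z → contradiction z≤n ¬z)
  where
  all : ∀ w → P w
  all zero    = p
  all (suc w) = up (all w)
threshold-cut zero P? up | no ¬p =
  1 , ≤-refl , (λ { z≤n () }) , (λ { z≤n _ → ¬p })
threshold-cut (suc n) P? up | no ¬p
  with m , m≤ , above , below ← threshold-cut n (P? ∘ suc) up =
  suc m , s≤s m≤ ,
  (λ { (s≤s w≤) (s≤s m≤w) → above w≤ m≤w }) ,
  (λ { z≤n _ → ¬p ; (s≤s w≤) m≰ → below w≤ (m≰ ∘ s≤s) })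

theorem5p5 : ∀ {k n : ℕ} (α : BoolFun k) (S : List (BoolFun n))
    .{{_ : NonZero (length S)}} →
    Monotone α → Unbalanced α →
    IsInitialSupport S → NoNegations S →
    ∃[ π ] (IsLimitingDistribution (uniform S) α π ×
    (∃[ m ] (m ≤ suc n × ConcentratedOn π (threshold m))))
theorem5p5 {n = n} α S mon unbalanced support noNeg
  with m , m≤ , above , below ← threshold-cut n
         (risesAt? α S mon unbalanced support noNeg) (risesAt-upward α S mon unbalanced support noNeg) =
  pointMass (threshold m) ,
  concentrates α S mon unbalanced support noNeg
    (λ x e → above (weight≤n x) (m≤weight x e))
    (λ x e → below (weight≤n x) (m≰weight x e)) ,
  m , m≤ ,
  cong (λ b → if b then 1ℚ else 0ℚ) (dec-true (threshold {n} m ≗? threshold m) (λ _ → refl))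
  where
  weight≤n : ∀ x → weight x ≤ n
  weight≤n = Vec.count≤n (Bool._≟ true)
  m≤weight : ∀ {m} x → threshold m x ≡ true → m ≤ weight x
  m≤weight {m} x e with m ≤? weight x
  ... | yes m≤w = m≤w
  ... | no  m≰w = contradiction (trans (sym e) (dec-false (m ≤? weight x) m≰w)) λ ()
  m≰weight : ∀ {m} x → threshold m x ≡ false → ¬ m ≤ weight x
  m≰weight {m} x e m≤w = contradiction (trans (sym e) (dec-true (m ≤? weight x) m≤w)) λ ()
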